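{- Let $Q\in\mathcal{Q}(n,d,m)$ and $\underline{\delta}\in\Omega_2(Q)$. Then $|\underline{\delta}|\leq m(d-n-1)+2n$.
   Context: A quiver $Q$ is a finite oriented graph; for an arrow $a$, $a''$ is its tail and $a'$ its head. A path $a=a_1\cdots a_s$ ($a_i$ arrows) satisfies $a_i'=a_{i+1}''$; it is closed if $a_1''=a_s'$; $V(a)=\{a_1'',a_1',\dots,a_s'\}$, $A(a)=\{a_1,\dots,a_s\}$. A closed path is primitive if each vertex of $V(a)$ is the head of exactly one $a_i$. $m(Q)$ is the maximal degree of a primitive closed path; $Q$ is strongly connected if some closed path contains all vertices; $\mathcal{Q}(n,d,m)$ is the set of strongly connected quivers with $n$ vertices, $d$ arrows and $m(Q)=m$. The multidegree $\mathrm{mdeg}(a)\in\mathbb{N}^{\#A(Q)}$ has $b$-component equal to the number of $i$ with $a_i=b$; $|\underline{\delta}|=\sum_b\delta_b$. For a nonzero $\underline{\delta}\in\mathbb{N}^{\#A(Q)}$, its support $Q_{\underline{\delta}}$ is the subquiver with arrows $\{a:\delta_a\geq1\}$ and vertices the heads and tails of these arrows; $\underline{\delta}$ is decomposable (with respect to $Q$) if $Q_{\underline{\delta}}$ is not strongly connected but is a disjoint union of strongly connected quivers. $\Omega_0(Q)$ is the set of $\mathrm{mdeg}(h)$ for closed paths $h$ in $Q$ with $A(h)=A(Q)$. A path $a$ is $\underline{\delta}$-double if it is a primitive closed path and $\delta_{a_i}\geq2$ for all $i$. $\Omega_2(Q)$ is the set of $\underline{\delta}\in\Omega_0(Q)$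 such that for every $\underline{\delta}$-double path $a$ in $Q$ the vector $\underline{\delta}-2\,\mathrm{mdeg}(a)$ is decomposable with respect to $Q$. -}

module Defs where

open import Level using (0ℓ)
open import Data.Nat.Base using (ℕ; _*_; _∸_; _≤_)
open import Data.Nat.Properties using (+-0-monoid)
open import Data.Fin.Base using (Fin)
open import Data.Fin.Properties using (_≟_)
open import Data.List.Base as List using (List; _∷_)
import Data.List.Membership.Propositional as Membership
open import Data.List.Relation.Unary.Linked using (Linked)
open import Data.List.NonEmpty.Base as List⁺ using (List⁺)
open import Data.Product.Base using (Σ-syntax; ∃-syntax; _×_; _,_)
open import Data.Product using (∃!)
open import Data.Sum.Base using (_⊎_; inj₁; inj₂)
open import Data.Unit.Base using (⊤; tt)
open import Data.Vec.Functional using (Vector)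
open import Relation.Nullary.Negation.Core using (¬_)
open import Relation.Binary.PropositionalEquality.Core using (_≡_; refl; _≢_; _≗_)
open import Relation.Unary using (Pred; _∈_; _⊆_; _≐_; _⊥_; ⋃)

import Algebra.Properties.Monoid.Sum +-0-monoid as Sum

-- Loops and parallel arrows are allowed.
record Quiver (n d : ℕ) : Set where
  field
    tail : Fin d → Fin n
    head : Fin d → Fin n

Multidegree : ℕ → Set
Multidegree d = Vector ℕ d

∣_∣ : ∀ {d} → Multidegree d → ℕ
∣ δ ∣ = Sum.sum δ

module _ {n d : ℕ} (Q : Quiver n d) where
  open Quiver Q

  -- A path has at least one arrow; there are no trivial paths at vertices.
  record Path : Set where
    field
      arrows : List⁺ (Fin d)
      linked : Linked (λ a b → head a ≡ tail b) (List⁺.toList arrows)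

    arrowList : List (Fin d)
    arrowList = List⁺.toList arrows

    degree : ℕ
    degree = List⁺.length arrows

    source : Fin n
    source = tail (List⁺.head arrows)

    target : Fin n
    target = head (List⁺.last arrows)

  open Path

  V : Path → Pred (Fin n) 0ℓ
  V a v = v Membership.∈ (source a ∷ List.map head (arrowList a))

  A : Path → Pred (Fin d) 0ℓ
  A a b = b Membership.∈ arrowList a

  Closed : Pred Path 0ℓ
  Closed a = source a ≡ target a

  PrimitiveClosed : Pred Path 0ℓ
  PrimitiveClosed a =
    Closed a ×
    (∀ v → v ∈ V a → ∃! _≡_ λ i → head (List.lookup (arrowList a) i) ≡ v)

  IsMaxPrimitiveDegree : ℕ → Set
  IsMaxPrimitiveDegree m =
    (∃[ a ] PrimitiveClosed a × degree a ≡ m) ×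
    (∀ a → PrimitiveClosed a → degree a ≤ m)

  record Subquiver : Set₁ where
    field
      vertexSet : Pred (Fin n) 0ℓ
      arrowSet  : Pred (Fin d) 0ℓ
      tail-closed : ∀ {b} → b ∈ arrowSet → tail b ∈ vertexSet
      head-closed : ∀ {b} → b ∈ arrowSet → head b ∈ vertexSet

  open Subquiver

  whole : Subquiver
  whole = record
    { vertexSet   = λ _ → ⊤
    ; arrowSet    = λ _ → ⊤
    ; tail-closed = λ _ → tt
    ; head-closed = λ _ → tt
    }

  -- The closed paths of Q lying in S are exactly the closed paths of the
  -- quiver S.
  StronglyConnected : Subquiver → Set
  StronglyConnected S =
    ∃[ h ] Closed h × A h ⊆ arrowSet S × vertexSet S ⊆ V h

  -- Disjointness of the arrow sets follows from that of the vertex sets.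
  IsDisjointUnionOfStronglyConnected : Subquiver → Set₁
  IsDisjointUnionOfStronglyConnected S =
    Σ[ k ∈ ℕ ] Σ[ T ∈ (Fin k → Subquiver) ]
      (∀ i → StronglyConnected (T i)) ×
      (∀ i j → i ≢ j → vertexSet (T i) ⊥ vertexSet (T j)) ×
      vertexSet S ≐ ⋃ (Fin k) (λ i → vertexSet (T i)) ×
      arrowSet S ≐ ⋃ (Fin k) (λ i → arrowSet (T i))

  mdeg : Path → Multidegree d
  mdeg a b = List.length (List.filter (_≟ b) (arrowList a))

  support : Multidegree d → Subquiver
  support δ = record
    { vertexSet   = λ v → ∃[ b ] 1 ≤ δ b × (v ≡ tail b ⊎ v ≡ head b)
    ; arrowSet    = λ b → 1 ≤ δ b
    ; tail-closed = λ p → _ , p , inj₁ refl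
    ; head-closed = λ p → _ , p , inj₂ refl
    }

  -- The notion is reserved for nonzero multidegrees: the zero vector is not
  -- decomposable.
  Decomposable : Multidegree d → Set₁
  Decomposable δ =
    (∃[ b ] δ b ≢ 0) ×
    ¬ StronglyConnected (support δ) ×
    IsDisjointUnionOfStronglyConnected (support δ)

  Ω₀ : Pred (Multidegree d) 0ℓ
  Ω₀ δ = ∃[ h ] Closed h × (∀ b → b ∈ A h) × δ ≗ mdeg h

  Double : Multidegree d → Pred Path 0ℓ
  Double δ a = PrimitiveClosed a × (∀ {b} → b ∈ A a → 2 ≤ δ b)

  -- Truncated subtraction is exact here: a primitive closed path passes
  -- through each of its arrows once, so 2 * mdeg a ≤ δ when a is δ-double.
  Ω₂ : Pred (Multidegree d) _
  Ω₂ δ = δ ∈ Ω₀ × (∀ a → Double δ a → Decomposable (λ b → δ b ∸ 2 * mdeg a b))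

𝒬 : ∀ n d → ℕ → Pred (Quiver n d) 0ℓ
𝒬 n d m Q = StronglyConnected Q (whole Q) × IsMaxPrimitiveDegree Q m

{-# OPTIONS --safe #-}
-- Write δ = 2 Σ aᵢ + Σ cⱼ, i ≤ k, j ≤ r, by repeatedly subtracting from a circulation σ ≤ δ twice
-- a σ-double cycle a, or once a cycle c that is not σ-double. Each step exhausts an arrow of the
-- support, so deleting these k + r arrows keeps the vertices connected and n + k + r ≤ d + 1.
-- As δ - 2aᵢ is decomposable, there is a cut Tᵢ that aᵢ crosses and δ - 2aᵢ does not, with arrows
-- of δ - 2aᵢ on both sides; in particular no other cycle of the decomposition crosses Tᵢ.
-- Splitting the vertices along the cuts, one at a time, replaces aᵢ by its two traces. At the end
-- there are k + 1 parts with 2k + r cycles and traces in all, at least two of them in each part. A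
-- cycle or trace has at most m vertices, and two of them in a part V together at most 2 |V|. Hence
-- Σ |aᵢ| + Σ |cⱼ| ≤ m (2k + r - 2 (k + 1)) + 2n = m (r - 2) + 2n, and with |aᵢ| ≤ m this gives
-- |δ| ≤ m (k + r - 2) + 2n ≤ m (d - n - 1) + 2n. When k = 0 and r = 1, use |δ| ≤ n and m ≤ n.
module Submission where

open import Defs

module _ where
  open import Data.Bool.Base using (Bool; true; false; not; if_then_else_; _∧_)
  import Data.Bool.Properties as Bool
  open import Data.Nat.Base
  open import Data.Nat.Properties hiding (_≟_)
  open import Algebra.Properties.Semiring.Sum +-*-semiring
    using (sum; sum-cong-≗; ∑-distrib-+; ∑-comm; *-distribˡ-sum)
  open import Data.Nat.Solver using (module +-*-Solver)
  open import Data.Nat.ListAction using () renaming (sum to sumˡ)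
  open import Data.Nat.ListAction.Properties using (sum-↭; sum-++)
  open import Data.Fin.Base using (Fin; zero; suc; punchIn; punchOut)
  open import Data.Fin.Properties
    using (_≟_; any?; injective⇒≤; punchInᵢ≢i; punchOut-punchIn; punchOut-cong)
  open import Data.List.Base as List using (List; []; _∷_; _++_; length; filter; allFin)
  open import Data.List.Properties using (map-++; length-++; length-map)
  open import Data.List.NonEmpty.Base as List⁺ using (List⁺; _∷_)
  open import Data.List.Membership.Propositional using (_∉_; find) renaming (_∈_ to _∈ˡ_)
  open import Data.List.Membership.DecPropositional using (_∈?_)
  open import Data.List.Membership.Propositional.Properties
    using (∈-map⁺; ∈-map⁻; ∈-filter⁺; ∈-filter⁻; ∈-allFin; ∈-lookup; ∈-++⁺ˡ; ∈-++⁺ʳ; ∈-++⁻)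
  open import Data.List.Relation.Unary.Any as Any using (here; there)
  open import Data.List.Relation.Unary.Any.Properties using (lookup-index)
  open import Data.List.Relation.Unary.All as All using (All; []; _∷_; all?)
  open import Data.List.Relation.Unary.All.Properties using (++⁻ˡ; ¬Any⇒All¬; ¬All⇒Any¬)
    renaming (map⁺ to All-map⁺; ++⁺ to All-++⁺)
  open import Data.List.Relation.Unary.AllPairs using ([]; _∷_)
  open import Data.List.Relation.Unary.Linked using (Linked; [-]; _∷_)
  open import Data.List.Relation.Unary.Unique.Propositional using (Unique)
  import Data.List.Relation.Unary.Unique.Propositional.Properties as Unique
  open import Data.List.Relation.Binary.Permutation.Propositional
    using (_↭_; ↭-refl; ↭-sym; ↭-trans; prep; swap)
  open import Data.List.Relation.Binary.Permutation.Propositional.Properties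
    using (map⁺; ++⁺; ++⁺ʳ; ++-comm; shift; shifts; ∈-resp-↭; ↭-length; ↭-map-inv)
  open import Data.Product using (∃!)
  open import Data.Product.Base using (Σ-syntax; ∃-syntax; _×_; _,_; proj₁; proj₂)
  open import Data.Sum.Base using (_⊎_; inj₁; inj₂)
  open import Data.Vec.Functional using (Vector)
  open import Function.Base using (_∘_; id)
  open import Relation.Binary.PropositionalEquality
    using (_≡_; _≢_; _≗_; refl; sym; trans; cong; cong₂; subst; subst₂; module ≡-Reasoning)
  open import Relation.Nullary.Decidable using (Dec; yes; no; does; ¬?; dec-true; dec-false)
  open import Relation.Nullary.Negation.Core using (¬_; contradiction)
  open import Relation.Unary using (_∈_)

  -- Finite sums and indicators

  sum-mono : ∀ {n} {f g : Vector ℕ n} → (∀ i → f i ≤ g i) → sum f ≤ sum g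
  sum-mono {zero}  f≤g = z≤n
  sum-mono {suc n} f≤g = +-mono-≤ (f≤g zero) (sum-mono (f≤g ∘ suc))

  term≤sum : ∀ {n} (f : Vector ℕ n) i → f i ≤ sum f
  term≤sum f zero    = m≤m+n _ _
  term≤sum f (suc i) = ≤-trans (term≤sum (f ∘ suc) i) (m≤n+m _ _)

  sum-one : ∀ n → sum {n} (λ _ → 1) ≡ n
  sum-one zero    = refl
  sum-one (suc n) = cong suc (sum-one n)

  sum-zero : ∀ n → sum {n} (λ _ → 0) ≡ 0
  sum-zero zero    = refl
  sum-zero (suc n) = sum-zero n

  sum-positive : ∀ {n} (f : Vector ℕ n) → 1 ≤ sum f → ∃[ i ] 1 ≤ f i
  sum-positive {suc n} f 1≤Σ with f zero in eq
  ... | suc k = zero , subst (1 ≤_) (sym eq) (s≤s z≤n)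
  ... | zero with sum-positive (f ∘ suc) 1≤Σ
  ...   | i , p = suc i , p

  sum-∸ : ∀ {n} {f g : Vector ℕ n} → (∀ i → g i ≤ f i) → sum (λ i → f i ∸ g i) + sum g ≡ sum f
  sum-∸ {f = f} {g} g≤f =
    trans (sym (∑-distrib-+ (λ i → f i ∸ g i) g)) (sum-cong-≗ λ i → m∸n+n≡m (g≤f i))

  -- The Iverson bracket.
  [_] : ∀ {p} {P : Set p} → Dec P → ℕ
  [ P? ] = if does P? then 1 else 0

  []-true : ∀ {p} {P : Set p} (P? : Dec P) → P → [ P? ] ≡ 1
  []-true (yes _) p = refl
  []-true (no ¬p) p = contradiction p ¬p

  []-positive : ∀ {p} {P : Set p} (P? : Dec P) → 1 ≤ [ P? ] → P
  []-positive (yes p) _ = p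

  sum-pick : ∀ {n} (j : Fin n) (g : Vector ℕ n) → sum (λ i → [ j ≟ i ] * g i) ≡ g j
  sum-pick {suc n} zero g = trans (cong₂ _+_ (+-identityʳ (g zero)) (sum-zero n)) (+-identityʳ _)
  sum-pick (suc j) g      = sum-pick j (g ∘ suc)

  -- Circulations

  module _ {n d : ℕ} (Q : Quiver n d) where
    open Quiver Q

    -- Conservation is tested against all vertex weights `φ`: the indicator of a vertex gives the
    -- balance there, the indicator of a level set the balance across a cut.
    Circulation : Multidegree d → Set
    Circulation σ = ∀ (φ : Fin n → ℕ) → sum (λ b → σ b * φ (head b)) ≡ sum (λ b → σ b * φ (tail b))

    inflow : Multidegree d → Vector ℕ n
    inflow σ v = sum λ b → σ b * [ head b ≟ v ]

    sum-inflow : ∀ σ → sum (inflow σ) ≡ sum σ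
    sum-inflow σ = trans (∑-comm (λ v b → σ b * [ head b ≟ v ])) (sum-cong-≗ λ b →
      trans (sum-cong-≗ (λ v → *-comm (σ b) [ head b ≟ v ])) (sum-pick (head b) (λ _ → σ b)))

    ≤inflow : ∀ σ b → σ b ≤ inflow σ (head b)
    ≤inflow σ b = ≤-trans
      (≤-reflexive (sym (trans (cong (σ b *_) ([]-true (head b ≟ head b) refl)) (*-identityʳ _))))
      (term≤sum (λ c → σ c * [ head c ≟ head b ]) b)

    inflow-positive : ∀ σ {v} → 1 ≤ inflow σ v → ∃[ b ] 1 ≤ σ b × head b ≡ v
    inflow-positive σ {v} p with sum-positive _ p
    ... | b , q with σ b in eq
    ...   | suc k = b , subst (1 ≤_) (sym eq) (s≤s z≤n) , []-positive (head b ≟ v) (1≤* (suc k) q)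
      where
      1≤* : ∀ k {x} → 1 ≤ k * x → 1 ≤ x
      1≤* k {zero}  p = contradiction p (subst (λ z → ¬ 1 ≤ z) (sym (*-zeroʳ k)) λ ())
      1≤* k {suc x} p = s≤s z≤n

    -- The outflow at `tail b` is at least `σ b`, and testing conservation against the indicator of
    -- that vertex turns it into inflow.
    tail-positive : ∀ {σ} → Circulation σ → ∀ {b} → 1 ≤ σ b → 1 ≤ inflow σ (tail b)
    tail-positive {σ} circ {b} p = ≤-trans p (≤-trans
      (≤-reflexive (sym (trans (cong (σ b *_) ([]-true (tail b ≟ tail b) refl)) (*-identityʳ _))))
      (≤-trans (term≤sum (λ c → σ c * [ tail c ≟ tail b ]) b)
        (≤-reflexive (sym (circ (λ v → [ v ≟ tail b ]))))))

    -- Truncated subtraction is exact under `τ ≤ σ`, so both sides can be completed by the sum for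
    -- `τ` and compared with the sums for `σ`.
    Circulation-∸ : ∀ {σ τ} → Circulation σ → Circulation τ → (∀ b → τ b ≤ σ b) →
      Circulation (λ b → σ b ∸ τ b)
    Circulation-∸ {σ} {τ} σ-circ τ-circ τ≤σ φ = +-cancelʳ-≡ (sum λ b → τ b * φ (head b)) _ _ (begin
      sum (λ b → (σ b ∸ τ b) * φ (head b)) + sum (λ b → τ b * φ (head b)) ≡⟨ lemma head ⟩
      sum (λ b → σ b * φ (head b))                                        ≡⟨ σ-circ φ ⟩
      sum (λ b → σ b * φ (tail b))                                        ≡⟨ lemma tail ⟨
      sum (λ b → (σ b ∸ τ b) * φ (tail b)) + sum (λ b → τ b * φ (tail b))
        ≡⟨ cong (sum (λ b → (σ b ∸ τ b) * φ (tail b)) +_) (τ-circ φ) ⟨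
      sum (λ b → (σ b ∸ τ b) * φ (tail b)) + sum (λ b → τ b * φ (head b)) ∎)
      where
      open ≡-Reasoning
      lemma : ∀ (end : Fin d → Fin n) →
        sum (λ b → (σ b ∸ τ b) * φ (end b)) + sum (λ b → τ b * φ (end b)) ≡ sum (λ b → σ b * φ (end b))
      lemma end = trans (sym (∑-distrib-+ (λ b → (σ b ∸ τ b) * φ (end b)) _)) (sum-cong-≗ λ b →
        trans (sym (*-distribʳ-+ (φ (end b)) (σ b ∸ τ b) (τ b))) (cong (_* φ (end b)) (m∸n+n≡m (τ≤σ b))))

    Circulation-* : ∀ k {σ} → Circulation σ → Circulation (λ b → k * σ b)
    Circulation-* k {σ} circ φ = trans (scale head) (trans (cong (k *_) (circ φ)) (sym (scale tail)))
      where
      scale : ∀ (end : Fin d → Fin n) → sum (λ b → k * σ b * φ (end b)) ≡ k * sum (λ b → σ b * φ (end b))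
      scale end = trans (sum-cong-≗ λ b → *-assoc k (σ b) _) (sym (*-distribˡ-sum k (λ b → σ b * φ (end b))))

    -- For a cut `f` this says that `b` does not cross it; for a quotient map of the vertices, that
    -- the ends of `b` are identified.
    Respects : ∀ {c} {C : Set c} → (Fin n → C) → Fin d → Set c
    Respects f b = f (tail b) ≡ f (head b)

    -- Test the circulation against the indicator function of a level set of f.
    respects-last : ∀ {σ} → Circulation σ → ∀ {k} (f : Fin n → Fin k) b₀ →
      (∀ b → 1 ≤ σ b → b ≢ b₀ → Respects f b) → 1 ≤ σ b₀ → Respects f b₀
    respects-last {σ} circ f b₀ others p = []-positive (f (tail b₀) ≟ f (head b₀))
      (subst (1 ≤_) (sym tail≡1) (s≤s z≤n))
      where
      φ : Fin n → ℕ
      φ v = [ f v ≟ f (head b₀) ]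
      off : ∀ (end : Fin d → Fin n) → Vector ℕ d
      off end b = if does (b₀ ≟ b) then 0 else σ b * φ (end b)
      split : ∀ (end : Fin d → Fin n) → sum (λ b → σ b * φ (end b)) ≡ σ b₀ * φ (end b₀) + sum (off end)
      split end = trans (sum-cong-≗ pointwise)
        (trans (∑-distrib-+ (λ b → [ b₀ ≟ b ] * (σ b * φ (end b))) (off end))
          (cong (_+ sum (off end)) (sum-pick b₀ (λ b → σ b * φ (end b)))))
        where
        pointwise : ∀ b → σ b * φ (end b) ≡ [ b₀ ≟ b ] * (σ b * φ (end b)) + off end b
        pointwise b with does (b₀ ≟ b)
        ... | true  = sym (trans (+-identityʳ _) (+-identityʳ _))
        ... | false = refl
      off≡ : off head ≗ off tail
      off≡ b with b₀ ≟ b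
      ... | yes _ = refl
      ... | no b₀≢b with σ b in eq
      ...   | zero  = refl
      ...   | suc k = cong (λ v → suc k * [ v ≟ f (head b₀) ])
        (sym (others b (subst (1 ≤_) (sym eq) (s≤s z≤n)) (b₀≢b ∘ sym)))
      -- All other arrows contribute equally at both ends, so `σ b₀` times `φ` is the same at both
      -- ends of `b₀`; the positive factor `σ b₀` cancels.
      tail≡1 : φ (tail b₀) ≡ 1
      tail≡1 = trans (sym (*-cancelˡ-≡ (φ (head b₀)) (φ (tail b₀)) (σ b₀) {{>-nonZero p}}
        (+-cancelʳ-≡ (sum (off tail)) _ _ (begin
          σ b₀ * φ (head b₀) + sum (off tail) ≡⟨ cong (σ b₀ * φ (head b₀) +_) (sum-cong-≗ off≡) ⟨
          σ b₀ * φ (head b₀) + sum (off head) ≡⟨ split head ⟨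
          sum (λ b → σ b * φ (head b))        ≡⟨ circ φ ⟩
          sum (λ b → σ b * φ (tail b))        ≡⟨ split tail ⟩
          σ b₀ * φ (tail b₀) + sum (off tail) ∎))))
        ([]-true (f (head b₀) ≟ f (head b₀)) refl)
        where open ≡-Reasoning

  -- Families of vertex multisets with cuts

  bipartition : ∀ {a p q} {A : Set a} {P : A → Set p} {Q : A → Set q} (xs : List A) →
    (∀ {x} → x ∈ˡ xs → P x ⊎ Q x) → ∃[ ys ] ∃[ zs ] xs ↭ ys ++ zs × All P ys × All Q zs
  bipartition [] _ = [] , [] , ↭-refl , [] , []
  bipartition (x ∷ xs) PQ with bipartition xs (PQ ∘ there) | PQ (here refl)
  ... | ys , zs , xs↭ , P , Q | inj₁ Px = x ∷ ys , zs , prep x xs↭ , Px ∷ P , Q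
  ... | ys , zs , xs↭ , P , Q | inj₂ Qx =
    ys , x ∷ zs , ↭-trans (prep x xs↭) (↭-sym (shift x ys zs)) , P , Qx ∷ Q

  module _ {n : ℕ} where

    Cut : Set
    Cut = Fin n → Bool

    OnSide : Cut → Bool → Vector ℕ n → Set
    OnSide T s x = ∀ v → 1 ≤ x v → T v ≡ s

    Uncut : Cut → Vector ℕ n → Set
    Uncut T x = ∃[ s ] OnSide T s x

    Nonzero : Vector ℕ n → Set
    Nonzero x = ∃[ v ] 1 ≤ x v

    Crosses : Cut → Vector ℕ n → Set
    Crosses T x = ∀ s → ∃[ v ] 1 ≤ x v × T v ≡ s

    Crosses⇒Nonzero : ∀ {T x} → Crosses T x → Nonzero x
    Crosses⇒Nonzero crosses with crosses true
    ... | v , p , _ = v , p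

    onlyOneSide : ∀ {T s x} → OnSide T s x → OnSide T (not s) x → Nonzero x → ∀ {ℓ} {A : Set ℓ} → A
    onlyOneSide p q (v , r) = contradiction (trans (sym (p v r)) (q v r)) (Bool.not-¬ refl)

    -- Entries off the side become zero instead of being dropped, so every part of a split keeps the
    -- index set `Fin n`.
    restrict : Cut → Bool → Vector ℕ n → Vector ℕ n
    restrict T s x v = if does (T v Bool.≟ s) then x v else 0

    restrict-positive : ∀ {T s x v} → 1 ≤ restrict T s x v → 1 ≤ x v × T v ≡ s
    restrict-positive {T} {s} {v = v} p with T v Bool.≟ s
    ... | yes Tv≡s = p , Tv≡s

    restrict-inside : ∀ T s x v → T v ≡ s → restrict T s x v ≡ x v
    restrict-inside T s x v Tv≡s with T v Bool.≟ s
    ... | yes _     = refl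
    ... | no Tv≢s = contradiction Tv≡s Tv≢s

    restrict-≤ : ∀ T s x v → restrict T s x v ≤ x v
    restrict-≤ T s x v with T v Bool.≟ s
    ... | yes _ = ≤-refl
    ... | no _  = z≤n

    restrict-mono : ∀ T s {x y} v → x v ≤ y v → restrict T s x v ≤ restrict T s y v
    restrict-mono T s v x≤y with T v Bool.≟ s
    ... | yes _ = x≤y
    ... | no _  = z≤n

    onSide⇒≤restrict : ∀ {T s x y} v → OnSide T s x → x v ≤ y v → x v ≤ restrict T s y v
    onSide⇒≤restrict {T} {s} {x} v side x≤y with T v Bool.≟ s
    ... | yes _   = x≤y
    ... | no Tv≢s with x v in eq
    ...   | zero  = z≤n
    ...   | suc _ = contradiction (side v (subst (1 ≤_) (sym eq) (s≤s z≤n))) Tv≢s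

    sum-restrict : ∀ T x → sum x ≡ sum (restrict T true x) + sum (restrict T false x)
    sum-restrict T x = trans (sum-cong-≗ pointwise) (∑-distrib-+ (restrict T true x) (restrict T false x))
      where
      pointwise : ∀ v → x v ≡ restrict T true x v + restrict T false x v
      pointwise v with T v
      ... | true  = sym (+-identityʳ _)
      ... | false = refl

    members : List (Vector ℕ n × Cut) → List (Vector ℕ n) → List (Vector ℕ n)
    members as cs = List.map proj₁ as ++ cs

    members-↭ : ∀ {as as′ cs cs′} → as ↭ as′ → cs ↭ cs′ → members as cs ↭ members as′ cs′
    members-↭ p q = ++⁺ (map⁺ proj₁ p) q

    members-++ : ∀ ys zs us ws → members (ys ++ zs) (us ++ ws) ↭ members ys us ++ members zs ws
    members-++ []       zs us ws = shifts (List.map proj₁ zs) us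
    members-++ (y ∷ ys) zs us ws = prep (proj₁ y) (members-++ ys zs us ws)

    members-nonempty : ∀ {ys us x} → x ∈ˡ members ys us → 1 ≤ length ys ⊎ 2 ≤ suc (length us)
    members-nonempty {_ ∷ _}      _ = inj₁ (s≤s z≤n)
    members-nonempty {[]} {_ ∷ _} _ = inj₂ (s≤s (s≤s z≤n))

    total : List (Vector ℕ n) → ℕ
    total xs = sumˡ (List.map sum xs)

    total-↭ : ∀ {xs ys} → xs ↭ ys → total xs ≡ total ys
    total-↭ p = sum-↭ (map⁺ sum p)

    total-++ : ∀ xs ys → total (xs ++ ys) ≡ total xs + total ys
    total-++ xs ys = trans (cong sumˡ (map-++ sum xs ys)) (sum-++ (List.map sum xs) (List.map sum ys))

    -- The invariant of the splitting. `V` bounds the multiplicities of vertices in the current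
    -- part; `as` holds the multisets still awaiting their cut, `cs` the others, including traces of
    -- those already cut. The fields about cuts quantify over permutations so that any entry can be
    -- moved to the front. `large` secures two members once `as` is empty.
    record Family (m : ℕ) (V : Vector ℕ n) (as : List (Vector ℕ n × Cut))
      (cs : List (Vector ℕ n)) : Set where
      field
        inside    : ∀ {x} → x ∈ˡ members as cs → ∀ v → x v ≤ V v
        bounded   : ∀ {x} → x ∈ˡ members as cs → sum x ≤ m
        connected : ∀ X → (∀ {x} → x ∈ˡ members as cs → Uncut X x) →
                    ∃[ s ] (∀ {x} → x ∈ˡ members as cs → OnSide X s x)
        crosses   : ∀ {a T as′} → as ↭ (a , T) ∷ as′ → Crosses T a
        uncut     : ∀ {a T as′} → as ↭ (a , T) ∷ as′ → ∀ {x} → x ∈ˡ members as′ cs → Uncut T x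
        sides     : ∀ {a T as′} → as ↭ (a , T) ∷ as′ → ∀ s →
                    ∃[ x ] x ∈ˡ members as′ cs × Nonzero x × OnSide T s x
        large     : 1 ≤ length as ⊎ 2 ≤ length cs

    open Family

    -- One part of a split along the cut `T` of `a`: `ys` and `us` are the members on side `s`, `zs`
    -- and `ws` those on the other side. The near members together with the trace of `a` form a
    -- family again.
    module _ {m V as cs a T ys zs us ws} (s : Bool) (F : Family m V as cs)
      (as↭ : as ↭ (a , T) ∷ (ys ++ zs)) (cs↭ : cs ↭ us ++ ws)
      (near : ∀ {x} → x ∈ˡ members ys us → OnSide T s x)
      (far  : ∀ {x} → x ∈ˡ members zs ws → OnSide T (not s) x)
      where

      private
        cs₁ : List (Vector ℕ n)
        cs₁ = restrict T s a ∷ us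

        part : ∀ {ys′ x} → x ∈ˡ members (ys′ ++ zs) cs → x ∈ˡ members ys′ us ⊎ x ∈ˡ members zs ws
        part {ys′} p = ∈-++⁻ (members ys′ us)
          (∈-resp-↭ (↭-trans (members-↭ ↭-refl cs↭) (members-++ ys′ zs us ws)) p)

        member⁻ : ∀ {ys′ x} → x ∈ˡ members ys′ cs₁ → x ≡ restrict T s a ⊎ x ∈ˡ members ys′ us
        member⁻ {ys′} p with ∈-resp-↭ (shift (restrict T s a) (List.map proj₁ ys′) us) p
        ... | here eq = inj₁ eq
        ... | there q = inj₂ q

        member⁺ : ∀ {ys′ x} → x ∈ˡ members ys′ us → x ∈ˡ members ys′ cs₁
        member⁺ {ys′} p = ∈-resp-↭ (↭-sym (shift (restrict T s a) (List.map proj₁ ys′) us)) (there p)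

        trace : ∀ ys′ → restrict T s a ∈ˡ members ys′ cs₁
        trace ys′ = ∈-++⁺ʳ (List.map proj₁ ys′) (here refl)

        old⁻ : ∀ {x} → x ∈ˡ members as cs → x ≡ a ⊎ x ∈ˡ members (ys ++ zs) cs
        old⁻ p with ∈-resp-↭ (members-↭ as↭ ↭-refl) p
        ... | here eq = inj₁ eq
        ... | there q = inj₂ q

        old⁺ : ∀ {x} → x ∈ˡ members ys us → x ∈ˡ members as cs
        old⁺ p = ∈-resp-↭ (↭-sym (members-↭ as↭ ↭-refl))
          (there (∈-resp-↭ (↭-sym (↭-trans (members-↭ ↭-refl cs↭) (members-++ ys zs us ws))) (∈-++⁺ˡ p)))

        a∈ : a ∈ˡ members as cs
        a∈ = ∈-resp-↭ (↭-sym (members-↭ as↭ ↭-refl)) (here refl)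

        trace-nonzero : Nonzero (restrict T s a)
        trace-nonzero with crosses F as↭ s
        ... | v , p , Tv≡s = v , subst (1 ≤_) (sym (restrict-inside T s a v Tv≡s)) p

        trace-onSide : ∀ {X t} → OnSide X t a → OnSide X t (restrict T s a)
        trace-onSide side v p = side v (proj₁ (restrict-positive {T} {s} {a} p))

        -- A cut X of the part T = s is extended to all vertices by giving the other part
        -- the colour that X has on the trace of a.
        connected₁ : ∀ X → (∀ {x} → x ∈ˡ members ys cs₁ → Uncut X x) →
                     ∃[ u ] (∀ {x} → x ∈ˡ members ys cs₁ → OnSide X u x)
        connected₁ X X-uncut with X-uncut (trace ys)
        ... | t , trace-side with connected F X′ old-uncut
          where
          X′ : Cut
          X′ v = if does (T v Bool.≟ s) then X v else t
          X′≡X : ∀ v → T v ≡ s → X′ v ≡ X v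
          X′≡X v Tv≡s with T v Bool.≟ s
          ... | yes _   = refl
          ... | no Tv≢s = contradiction Tv≡s Tv≢s
          old-uncut : ∀ {x} → x ∈ˡ members as cs → Uncut X′ x
          old-uncut p with old⁻ p
          ... | inj₁ refl = t , a-side
            where
            a-side : OnSide X′ t a
            a-side v 1≤av with T v Bool.≟ s
            ... | yes Tv≡s = trace-side v (subst (1 ≤_) (sym (restrict-inside T s a v Tv≡s)) 1≤av)
            ... | no _     = refl
          ... | inj₂ q with part {ys} q
          ...   | inj₁ r with X-uncut (member⁺ {ys} r)
          ...     | t′ , side = t′ , λ v 1≤xv → trans (X′≡X v (near r v 1≤xv)) (side v 1≤xv)
          old-uncut p | inj₂ q | inj₂ r = t , far-side
            where
            far-side : OnSide X′ t _
            far-side v 1≤xv with T v Bool.≟ s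
            ... | yes Tv≡s = contradiction (trans (sym Tv≡s) (far r v 1≤xv)) (Bool.not-¬ refl)
            ... | no _     = refl
        ... | u , old-side = u , new-side
          where
          X′≡X : ∀ v → T v ≡ s → (if does (T v Bool.≟ s) then X v else t) ≡ X v
          X′≡X v Tv≡s with T v Bool.≟ s
          ... | yes _   = refl
          ... | no Tv≢s = contradiction Tv≡s Tv≢s
          new-side : ∀ {x} → x ∈ˡ members ys cs₁ → OnSide X u x
          new-side p v 1≤xv with member⁻ {ys} p
          ... | inj₁ refl with restrict-positive {T} {s} {a} 1≤xv
          ...   | 1≤av , Tv≡s = trans (sym (X′≡X v Tv≡s)) (old-side a∈ v 1≤av)
          new-side p v 1≤xv | inj₂ q = trans (sym (X′≡X v (near q v 1≤xv))) (old-side (old⁺ q) v 1≤xv)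

        module _ {b S ys′} (ys↭ : ys ↭ (b , S) ∷ ys′) where

          as↭b : as ↭ (b , S) ∷ (a , T) ∷ (ys′ ++ zs)
          as↭b = ↭-trans as↭ (↭-trans (prep (a , T) (++⁺ʳ zs ys↭)) (swap (a , T) (b , S) ↭-refl))

          b-near : OnSide T s b
          b-near = near (∈-resp-↭ (↭-sym (members-↭ ys↭ ↭-refl)) (here refl))

          rest⊆ : ∀ {x} → x ∈ˡ members ys′ us → x ∈ˡ members (ys′ ++ zs) cs
          rest⊆ p = ∈-resp-↭ (↭-sym (↭-trans (members-↭ ↭-refl cs↭) (members-++ ys′ zs us ws))) (∈-++⁺ˡ p)

          uncut₁ : ∀ {x} → x ∈ˡ members ys′ cs₁ → Uncut S x
          uncut₁ p with member⁻ {ys′} p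
          ... | inj₂ q = uncut F as↭b (there (rest⊆ q))
          -- `S` does not cut `a`, hence does not cut its trace.
          ... | inj₁ refl with uncut F as↭b (here refl)
          ...   | t , side = t , trace-onSide side

          -- No member leaves the quadrant T ≢ s, S ≡ t, so by connectedness none lies in it.
          quadrant : ∀ {t x} → OnSide S (not t) a → x ∈ˡ members as cs → Nonzero x →
                     OnSide T (not s) x → OnSide S t x → ∀ {ℓ} {A : Set ℓ} → A
          quadrant {t} {x} a-side x∈ (v , 1≤xv) x-far x-side with connected F X X-uncut
            where
            X : Cut
            X v = does (T v Bool.≟ not s) ∧ does (S v Bool.≟ t)
            X-uncut : ∀ {y} → y ∈ˡ members as cs → Uncut X y
            X-uncut p with ∈-resp-↭ (members-↭ as↭b ↭-refl) p
            ... | here refl = false , b-out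
              where
              b-out : OnSide X false b
              b-out w q with T w Bool.≟ not s
              ... | yes Tw≡ = contradiction (trans (sym (b-near w q)) Tw≡) (Bool.not-¬ refl)
              ... | no _ = refl
            ... | there (here refl) = false , a-out
              where
              a-out : OnSide X false a
              a-out w q with S w Bool.≟ t
              ... | yes Sw≡ = contradiction (trans (sym Sw≡) (a-side w q)) (Bool.not-¬ refl)
              ... | no _ = Bool.∧-zeroʳ _
            -- Every other member is uncut by both `S` and `T`, so both tests, and with them `X`,
            -- are constant on it.
            ... | there (there q)
                with uncut F as↭b (there q)
                   | uncut F (↭-trans as↭b (swap _ _ ↭-refl)) (there q)
            ...   | t₁ , S-side | t₂ , T-side = does (t₂ Bool.≟ not s) ∧ does (t₁ Bool.≟ t) ,
              λ w r → cong₂ (λ p q → does (p Bool.≟ not s) ∧ does (q Bool.≟ t)) (T-side w r) (S-side w r)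
          ... | u , side = contradiction
            (trans (sym (side x∈ v 1≤xv)) x-in) λ u≡true → absurd u≡true
            where
            x-in : (does (T v Bool.≟ not s) ∧ does (S v Bool.≟ t)) ≡ true
            x-in rewrite x-far v 1≤xv | x-side v 1≤xv with not s Bool.≟ not s | t Bool.≟ t
            ... | yes _ | yes _ = refl
            ... | no ≢  | _     = contradiction refl ≢
            ... | yes _ | no ≢  = contradiction refl ≢
            absurd : ∀ {ℓ} {A : Set ℓ} → u ≡ true → A
            -- `b` is nonzero and lies on side `s` of `T`, so `X` is false somewhere on a member and
            -- `u` cannot be true.
            absurd refl with Crosses⇒Nonzero (crosses F as↭b)
            ... | w , r with trans (sym (side (∈-resp-↭ (↭-sym (members-↭ as↭b ↭-refl)) (here refl)) w r)) b-out
              where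
              b-out : (does (T w Bool.≟ not s) ∧ does (S w Bool.≟ t)) ≡ false
              b-out with T w Bool.≟ not s
              ... | yes Tw≡ = contradiction (trans (sym (b-near w r)) Tw≡) (Bool.not-¬ refl)
              ... | no _ = refl
            ... | ()

          -- `S` leaves `a` on one side, where the trace serves as witness. On the other side, a
          -- witness from `F` different from `a` cannot be far, by `quadrant`, so it survives in
          -- this part.
          sides₁ : ∀ t → ∃[ x ] x ∈ˡ members ys′ cs₁ × Nonzero x × OnSide S t x
          sides₁ t with uncut F as↭b (here refl)
          ... | t′ , a-side with t′ Bool.≟ t
          ...   | yes refl = restrict T s a , trace ys′ , trace-nonzero , trace-onSide a-side
          ...   | no t′≢t with sides F as↭b t
          ...     | x , here refl , x≢0 , side = restrict T s a , trace ys′ , trace-nonzero , trace-onSide side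
          ...     | x , there p , x≢0 , side with part {ys′} p
          ...       | inj₁ q = x , member⁺ {ys′} q , x≢0 , side
          ...       | inj₂ q = quadrant (λ v r → trans (a-side v r) (Bool.¬-not t′≢t))
            (∈-resp-↭ (↭-sym (members-↭ as↭b ↭-refl)) (there (there p))) x≢0 (far q) side

        -- Besides `a`, `sides` gives a nonzero member on side `s`. It belongs to this part and
        -- either still carries a cut or joins the trace in `cs₁`.
        large₁ : 1 ≤ length ys ⊎ 2 ≤ length cs₁
        large₁ with sides F as↭ s
        ... | x , p , x≢0 , side with part {ys} p
        ...   | inj₂ q = onlyOneSide side (far q) x≢0
        ...   | inj₁ q = members-nonempty {ys} q

      restrictFamily : Family m (restrict T s V) ys cs₁
      restrictFamily .inside p v with member⁻ {ys} p
      ... | inj₁ refl = restrict-mono T s {a} {V} v (inside F a∈ v)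
      ... | inj₂ q    = onSide⇒≤restrict {y = V} v (near q) (inside F (old⁺ q) v)
      restrictFamily .bounded p with member⁻ {ys} p
      ... | inj₁ refl = ≤-trans (sum-mono (restrict-≤ T s a)) (bounded F a∈)
      ... | inj₂ q    = bounded F (old⁺ q)
      restrictFamily .connected = connected₁
      restrictFamily .crosses ys↭ = crosses F (as↭b ys↭)
      restrictFamily .uncut = uncut₁
      restrictFamily .sides = sides₁
      restrictFamily .large = large₁

    total-bound : ∀ {m} xs → (∀ {x} → x ∈ˡ xs → sum x ≤ m) → total xs ≤ m * length xs
    total-bound []       bound = z≤n
    total-bound {m} (x ∷ xs) bound = ≤-trans (+-mono-≤ (bound (here refl)) (total-bound xs (bound ∘ there)))
      (≤-reflexive (sym (*-suc m (length xs))))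

    -- Cutting along T replaces a by its two traces, which no longer carry a cut.
    family-bound : ∀ {m V as cs} k → length as ≤ k → Family m V as cs →
      total (members as cs) + 2 * m ≤ m * length cs + 2 * sum V
    -- No cuts remain: two members fit into `V` and each of the others has total at most `m`.
    family-bound {m} {V} {[]} {c₁ ∷ c₂ ∷ cs} k _ F = begin
      sum c₁ + (sum c₂ + total cs) + 2 * m
        ≤⟨ +-monoˡ-≤ (2 * m) (+-mono-≤ (sum-mono (inside F (here refl)))
             (+-mono-≤ (sum-mono (inside F (there (here refl))))
             (total-bound cs (λ p → bounded F (there (there p)))))) ⟩
      sum V + (sum V + m * length cs) + 2 * m
        ≡⟨ solve 3 (λ V m r → V :+ (V :+ m :* r) :+ con 2 :* m := m :* (con 2 :+ r) :+ con 2 :* V) refl (sum V) m (length cs) ⟩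
      m * length (c₁ ∷ c₂ ∷ cs) + 2 * sum V ∎
      where
      open ≤-Reasoning
      open +-*-Solver
    family-bound {as = []} {[]} k _ F with large F
    ... | inj₁ ()
    ... | inj₂ ()
    family-bound {as = []} {_ ∷ []} k _ F with large F
    ... | inj₁ ()
    ... | inj₂ (s≤s ())
    family-bound {m} {V} {(a , T) ∷ as} {cs} (suc k) (s≤s as≤k) F
      with bipartition {P = OnSide T true ∘ proj₁} {Q = OnSide T false ∘ proj₁} as
             (λ p → side (uncut F ↭-refl (∈-++⁺ˡ (∈-map⁺ proj₁ p))))
         | bipartition {P = OnSide T true} {Q = OnSide T false} cs
             (λ p → side (uncut F ↭-refl (∈-++⁺ʳ (List.map proj₁ as) p)))
      where
      side : ∀ {x} → Uncut T x → OnSide T true x ⊎ OnSide T false x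
      side (true  , p) = inj₁ p
      side (false , p) = inj₂ p
    ... | ys , zs , as↭ , ysT , zsF | us , ws , cs↭ , usT , wsF =
      -- Each part brings its own `2 * m` on the left. The surplus one is matched on the right by
      -- the two traces, each of which lengthens a list without cuts by one.
      +-cancelʳ-≤ (2 * m) _ _ (begin
        sum a + total (members as cs) + 2 * m + 2 * m
          ≡⟨ cong (λ z → z + 2 * m + 2 * m) (cong₂ _+_ (sum-restrict T a) total-split) ⟩
        at + af + (ty + tu + (tz + tw)) + 2 * m + 2 * m
          ≡⟨ solve 7 (λ at af ty tu tz tw m →
               at :+ af :+ (ty :+ tu :+ (tz :+ tw)) :+ con 2 :* m :+ con 2 :* m :=
               (ty :+ (at :+ tu) :+ con 2 :* m) :+ (tz :+ (af :+ tw) :+ con 2 :* m))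
               refl at af ty tu tz tw m ⟩
        (ty + (at + tu) + 2 * m) + (tz + (af + tw) + 2 * m)
          ≤⟨ +-mono-≤ boundT boundF ⟩
        (m * suc (length us) + 2 * Vt) + (m * suc (length ws) + 2 * Vf)
          ≡⟨ solve 5 (λ m u w Vt Vf →
               (m :* (con 1 :+ u) :+ con 2 :* Vt) :+ (m :* (con 1 :+ w) :+ con 2 :* Vf) :=
               m :* (u :+ w) :+ con 2 :* (Vt :+ Vf) :+ con 2 :* m)
               refl m (length us) (length ws) Vt Vf ⟩
        m * (length us + length ws) + 2 * (Vt + Vf) + 2 * m
          ≡⟨ cong₂ (λ p q → m * p + 2 * q + 2 * m) (trans (↭-length cs↭) (length-++ us)) (sum-restrict T V) ⟨
        m * length cs + 2 * sum V + 2 * m ∎)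
      where
      open ≤-Reasoning
      open +-*-Solver
      at af ty tu tz tw Vt Vf : ℕ
      at = sum (restrict T true a)
      af = sum (restrict T false a)
      ty = total (List.map proj₁ ys)
      tu = total us
      tz = total (List.map proj₁ zs)
      tw = total ws
      Vt = sum (restrict T true V)
      Vf = sum (restrict T false V)
      total-split : total (members as cs) ≡ ty + tu + (tz + tw)
      total-split = trans (total-↭ (↭-trans (members-↭ as↭ cs↭) (members-++ ys zs us ws)))
        (trans (total-++ (members ys us) (members zs ws))
          (cong₂ _+_ (total-++ (List.map proj₁ ys) us) (total-++ (List.map proj₁ zs) ws)))
      -- `ys` and `zs` are known only through a permutation of `as`, so the recursion runs on the
      -- bound `k`.
      ys≤k : length ys ≤ k
      ys≤k = ≤-trans (≤-trans (m≤m+n _ _) (≤-reflexive (sym (trans (↭-length as↭) (length-++ ys))))) as≤k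
      zs≤k : length zs ≤ k
      zs≤k = ≤-trans (≤-trans (m≤n+m _ (length ys)) (≤-reflexive (sym (trans (↭-length as↭) (length-++ ys))))) as≤k
      insideT : ∀ {x} → x ∈ˡ members ys us → OnSide T true x
      insideT = All.lookup (All-++⁺ (All-map⁺ ysT) usT)
      insideF : ∀ {x} → x ∈ˡ members zs ws → OnSide T false x
      insideF = All.lookup (All-++⁺ (All-map⁺ zsF) wsF)
      boundT : ty + (at + tu) + 2 * m ≤ m * suc (length us) + 2 * Vt
      boundT = subst (λ z → z + 2 * m ≤ m * suc (length us) + 2 * Vt)
        (total-++ (List.map proj₁ ys) (restrict T true a ∷ us))
        (family-bound k ys≤k (restrictFamily {ys = ys} {zs} {us} {ws} true F (prep _ as↭) cs↭ insideT insideF))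
      boundF : tz + (af + tw) + 2 * m ≤ m * suc (length ws) + 2 * Vf
      boundF = subst (λ z → z + 2 * m ≤ m * suc (length ws) + 2 * Vf)
        (total-++ (List.map proj₁ zs) (restrict T false a ∷ ws))
        (family-bound k zs≤k (restrictFamily {ys = zs} {ys} {ws} {us} false F
          (prep _ (↭-trans as↭ (++-comm ys zs))) (↭-trans cs↭ (++-comm us ws)) insideF insideT))

  -- Paths and cycles

  count : ∀ {k} → List (Fin k) → Vector ℕ k
  count l b = length (filter (_≟ b) l)

  count-∷ : ∀ {k} x (l : List (Fin k)) b → count (x ∷ l) b ≡ [ x ≟ b ] + count l b
  count-∷ x l b with does (x ≟ b)
  ... | true  = refl
  ... | false = refl

  sum-count : ∀ {k} (l : List (Fin k)) g → sum (λ b → count l b * g b) ≡ sumˡ (List.map g l)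
  sum-count {k} [] g = sum-zero k
  sum-count (x ∷ l) g = begin
    sum (λ b → count (x ∷ l) b * g b)
      ≡⟨ sum-cong-≗ (λ b → trans (cong (_* g b) (count-∷ x l b)) (*-distribʳ-+ (g b) [ x ≟ b ] (count l b))) ⟩
    sum (λ b → [ x ≟ b ] * g b + count l b * g b)
      ≡⟨ ∑-distrib-+ (λ b → [ x ≟ b ] * g b) (λ b → count l b * g b) ⟩
    sum (λ b → [ x ≟ b ] * g b) + sum (λ b → count l b * g b)
      ≡⟨ cong₂ _+_ (sum-pick x g) (sum-count l g) ⟩
    g x + sumˡ (List.map g l) ∎
    where open ≡-Reasoning

  sum-count≡length : ∀ {k} (l : List (Fin k)) → sum (count l) ≡ length l
  sum-count≡length l = trans (sum-cong-≗ λ b → sym (*-identityʳ (count l b)))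
    (trans (sum-count l (λ _ → 1)) (ones l))
    where
    ones : ∀ l → sumˡ (List.map (λ _ → 1) l) ≡ length l
    ones []      = refl
    ones (_ ∷ l) = cong suc (ones l)

  count-∈ : ∀ {k} {b : Fin k} {l} → b ∈ˡ l → 1 ≤ count l b
  count-∈ {b = b} {x ∷ l} p rewrite count-∷ x l b with p
  ... | here b≡x = ≤-trans (≤-reflexive (sym ([]-true (x ≟ b) (sym b≡x)))) (m≤m+n _ _)
  ... | there q  = ≤-trans (count-∈ q) (m≤n+m _ _)

  count-∉ : ∀ {k} {b : Fin k} {l} → All (b ≢_) l → count l b ≡ 0
  count-∉ []                         = refl
  count-∉ {b = b} {x ∷ l} (b≢x ∷ b∉) rewrite count-∷ x l b with x ≟ b
  ... | yes x≡b = contradiction (sym x≡b) b≢x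
  ... | no _    = count-∉ b∉

  ∈-count : ∀ {k} {b : Fin k} {l} → 1 ≤ count l b → b ∈ˡ l
  ∈-count {b = b} {l} p with _∈?_ _≟_ b l
  ... | yes b∈l = b∈l
  ... | no b∉l  = contradiction (subst (1 ≤_) (count-∉ (¬Any⇒All¬ l b∉l)) p) λ ()

  Unique⇒count≤1 : ∀ {k} {l : List (Fin k)} → Unique l → ∀ b → count l b ≤ 1
  Unique⇒count≤1 [] b = z≤n
  Unique⇒count≤1 {l = x ∷ l} (x∉l ∷ u) b rewrite count-∷ x l b with x ≟ b
  ... | yes refl = ≤-reflexive (cong suc (count-∉ x∉l))
  ... | no _     = Unique⇒count≤1 u b

  -- Pigeonhole: the length is the sum of the counts, each at most one.
  Unique⇒length≤ : ∀ {k} {l : List (Fin k)} → Unique l → length l ≤ k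
  Unique⇒length≤ {k} {l} u = ≤-trans (≤-reflexive (sym (sum-count≡length l)))
    (≤-trans (sum-mono (Unique⇒count≤1 u)) (≤-reflexive (sum-one k)))

  module _ {a b} {A : Set a} {B : Set b} {f : A → B} where

    Unique-map-++⁻ˡ : ∀ xs {ys} → Unique (List.map f (xs ++ ys)) → Unique (List.map f xs)
    Unique-map-++⁻ˡ []       _        = []
    Unique-map-++⁻ˡ (x ∷ xs) {ys} (x∉ ∷ u) =
      ++⁻ˡ (List.map f xs) (subst (All (f x ≢_)) (map-++ f xs ys) x∉) ∷ Unique-map-++⁻ˡ xs u

    lookup-map-injective : ∀ {l} → Unique (List.map f l) → ∀ {i j} →
      f (List.lookup l i) ≡ f (List.lookup l j) → i ≡ j
    lookup-map-injective {_ ∷ _} _       {zero}  {zero}  _  = refl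
    lookup-map-injective {_ ∷ _} (x∉ ∷ _) {zero}  {suc j} eq =
      contradiction eq (All.lookup x∉ (∈-map⁺ f (∈-lookup j)))
    lookup-map-injective {_ ∷ _} (x∉ ∷ _) {suc i} {zero}  eq =
      contradiction (sym eq) (All.lookup x∉ (∈-map⁺ f (∈-lookup i)))
    lookup-map-injective {_ ∷ _} (_ ∷ u) {suc i} {suc j} eq = cong suc (lookup-map-injective u eq)

  last-∷ : ∀ {a} {A : Set a} (x y : A) l → List⁺.last (x ∷ y ∷ l) ≡ List⁺.last (y ∷ l)
  last-∷ x y l with List.initLast l
  ... | []            = refl
  ... | _ List.∷ʳ′ _ = refl

  last∈ : ∀ {a} {A : Set a} (x : A) l → List⁺.last (x ∷ l) ∈ˡ x ∷ l
  last∈ x []      = here refl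
  last∈ x (y ∷ l) = there (subst (_∈ˡ y ∷ l) (sym (last-∷ x y l)) (last∈ y l))

  module _ {n d : ℕ} (Q : Quiver n d) where
    open Quiver Q
    open Path

    private
      Composable : List (Fin d) → Set
      Composable = Linked (λ a b → head a ≡ tail b)

    -- The head of each arrow is the tail of the next, so only the terms at the two ends of the path
    -- differ; for a closed path these cancel.
    telescope : ∀ (φ : Fin n → ℕ) {x l} → Composable (x ∷ l) →
      sumˡ (List.map (φ ∘ head) (x ∷ l)) + φ (tail x) ≡
      sumˡ (List.map (φ ∘ tail) (x ∷ l)) + φ (head (List⁺.last (x ∷ l)))
    telescope φ {x} [-] = solve 2 (λ h t → (h :+ con 0) :+ t := (t :+ con 0) :+ h) refl (φ (head x)) (φ (tail x))
      where open +-*-Solver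
    telescope φ {x} {y ∷ l} (hx≡ty ∷ lk) = begin
      φ (head x) + sh + φ (tail x)                          ≡⟨ cong (λ v → φ v + sh + φ (tail x)) hx≡ty ⟩
      φ (tail y) + sh + φ (tail x)
        ≡⟨ solve 3 (λ a b c → a :+ b :+ c := c :+ (b :+ a)) refl (φ (tail y)) sh (φ (tail x)) ⟩
      φ (tail x) + (sh + φ (tail y))                        ≡⟨ cong (φ (tail x) +_) (telescope φ lk) ⟩
      φ (tail x) + (st + φ (head (List⁺.last (y ∷ l))))     ≡⟨ +-assoc (φ (tail x)) st _ ⟨
      φ (tail x) + st + φ (head (List⁺.last (y ∷ l)))
        ≡⟨ cong (λ z → φ (tail x) + st + φ (head z)) (last-∷ x y l) ⟨
      φ (tail x) + st + φ (head (List⁺.last (x ∷ y ∷ l)))   ∎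
      where
      open ≡-Reasoning
      open +-*-Solver
      sh st : ℕ
      sh = sumˡ (List.map (φ ∘ head) (y ∷ l))
      st = sumˡ (List.map (φ ∘ tail) (y ∷ l))

    mdeg-circulation : ∀ p → Closed Q p → Circulation Q (mdeg Q p)
    mdeg-circulation p closed φ = trans (sum-count (arrowList p) (φ ∘ head))
      (trans (+-cancelʳ-≡ (φ (source p)) _ _
        (trans (telescope φ (linked p)) (cong (λ v → sumˡ (List.map (φ ∘ tail) (arrowList p)) + φ v) (sym closed))))
      (sym (sum-count (arrowList p) (φ ∘ tail))))

    sum-mdeg : ∀ p → sum (mdeg Q p) ≡ degree p
    sum-mdeg p = sum-count≡length (arrowList p)

    inflow-mdeg : ∀ p v → inflow Q (mdeg Q p) v ≡ count (List.map head (arrowList p)) v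
    inflow-mdeg p v = trans (sum-count (arrowList p) (λ b → [ head b ≟ v ])) (go (arrowList p))
      where
      go : ∀ l → sumˡ (List.map (λ b → [ head b ≟ v ]) l) ≡ count (List.map head l) v
      go []      = refl
      go (x ∷ l) = trans (cong ([ head x ≟ v ] +_) (go l)) (sym (count-∷ (head x) (List.map head l) v))

    respects⇒constant : ∀ {c} {C : Set c} (f : Fin n → C) (p : Path Q) →
      (∀ {b} → b ∈ˡ arrowList p → Respects Q f b) → ∀ {b} → b ∈ˡ arrowList p → f (head b) ≡ f (source p)
    respects⇒constant f p = go (linked p)
      where
      go : ∀ {x l} → Composable (x ∷ l) → (∀ {b} → b ∈ˡ x ∷ l → Respects Q f b) →
           ∀ {b} → b ∈ˡ x ∷ l → f (head b) ≡ f (tail x)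
      go _              resp (here refl) = sym (resp (here refl))
      go (hx≡ty ∷ lk) resp (there q)   =
        trans (go lk (resp ∘ there) q) (trans (cong f (sym hx≡ty)) (sym (resp (here refl))))

    -- The walk is cut off after an arrow ending at `v`. When `v` is the tail of `x`, the initial
    -- piece is a closed path.
    closeUp : ∀ {x l} → Composable (x ∷ l) → ∀ {v} → v ∈ˡ List.map head (x ∷ l) →
      ∃[ l₁ ] ∃[ l₂ ] l₁ ++ l₂ ≡ l × Composable (x ∷ l₁) × v ≡ head (List⁺.last (x ∷ l₁))
    closeUp {l = l} lk (here eq) = [] , l , refl , [-] , eq
    closeUp {x} {y ∷ l} (hx≡ty ∷ lk) (there p) with closeUp lk p
    ... | l₁ , l₂ , refl , lk₁ , eq =
      y ∷ l₁ , l₂ , refl , hx≡ty ∷ lk₁ , trans eq (cong head (sym (last-∷ x y l₁)))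

    -- Primitivity in a form that passes to initial pieces of a walk and bounds multiplicities
    -- directly.
    UniqueHeads : Path Q → Set
    UniqueHeads p = Unique (List.map head (arrowList p))

    uniqueHeads⇒PrimitiveClosed : ∀ p → Closed Q p → UniqueHeads p → PrimitiveClosed Q p
    uniqueHeads⇒PrimitiveClosed p closed unique = closed , visited
      where
      index : ∀ {v} → v ∈ˡ List.map head (arrowList p) → ∃[ i ] head (List.lookup (arrowList p) i) ≡ v
      index q with ∈-map⁻ head q
      ... | b , b∈ , refl = Any.index b∈ , cong head (sym (lookup-index b∈))
      visited : ∀ v → V Q p v → ∃! _≡_ λ i → head (List.lookup (arrowList p) i) ≡ v
      visited v q with index (toHeads q)
        where
        toHeads : V Q p v → v ∈ˡ List.map head (arrowList p)
        toHeads (here refl) = subst (_∈ˡ List.map head (arrowList p)) (sym closed) (∈-map⁺ head (last∈ _ _))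
        toHeads (there q)   = q
      ... | i , eq = i , eq , λ eq′ → lookup-map-injective unique (trans eq (sym eq′))

    PrimitiveClosed⇒degree≤n : ∀ p → PrimitiveClosed Q p → degree p ≤ n
    PrimitiveClosed⇒degree≤n p (_ , visited) = injective⇒≤ {f = λ i → head (List.lookup (arrowList p) i)} injective
      where
      injective : ∀ {i j} → head (List.lookup (arrowList p) i) ≡ head (List.lookup (arrowList p) j) → i ≡ j
      injective {i} {j} eq with visited _ (there (∈-map⁺ head (∈-lookup i)))
      ... | _ , _ , unique = trans (sym (unique refl)) (unique (sym eq))

    module _ {σ : Multidegree d} (circ : Circulation Q σ) where

      -- Follow the arrows of the support backwards until a vertex repeats.
      findCycle : ∀ b → 1 ≤ σ b →
        ∃[ p ] Closed Q p × UniqueHeads p × All (λ b → 1 ≤ σ b) (arrowList p)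
      findCycle b p = search n (≤-reflexive (+-comm 1 n)) [-] ([] ∷ []) (p ∷ [])
        where
        search : ∀ k {x l} → n < k + length (x ∷ l) → Composable (x ∷ l) →
          Unique (List.map head (x ∷ l)) → All (λ b → 1 ≤ σ b) (x ∷ l) →
          ∃[ p ] Closed Q p × UniqueHeads p × All (λ b → 1 ≤ σ b) (arrowList p)
        -- The fuel cannot run out, since distinct heads allow at most `n` arrows.
        search zero {x} {l} n<len lk u supp =
          contradiction (≤-trans (≤-reflexive (sym (length-map head (x ∷ l)))) (Unique⇒length≤ u)) (<⇒≱ n<len)
        search (suc k) {x} {l} n<len lk u (px ∷ supp) with _∈?_ _≟_ (tail x) (List.map head (x ∷ l))
        ... | yes q with closeUp lk q
        ...   | l₁ , l₂ , refl , lk₁ , closed =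
          record { arrows = x ∷ l₁ ; linked = lk₁ } , closed , Unique-map-++⁻ˡ (x ∷ l₁) u , px ∷ ++⁻ˡ l₁ supp
        -- Conservation supplies a support arrow ending at `tail x`; this vertex is not yet a head,
        -- so prepending the arrow keeps the heads distinct.
        search (suc k) {x} {l} n<len lk u (px ∷ supp) | no tx∉ with inflow-positive Q σ (tail-positive Q {σ} circ px)
        ... | b , pb , hb≡tx = search k (subst (n <_) (sym (+-suc k _)) n<len) (hb≡tx ∷ lk)
          (¬Any⇒All¬ _ (subst (λ v → v ∉ List.map head (x ∷ l)) (sym hb≡tx) tx∉) ∷ u) (pb ∷ px ∷ supp)

  -- Decomposing a circulation into cycles

  module _ {n d : ℕ} (Q : Quiver n d) where
    open Quiver Q
    open Path

    -- `f` is a quotient map that contracts the arrows of `L`; each of them costs at most one class.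
    contraction : ∀ L → ∃[ k ] Σ[ f ∈ (Fin n → Fin k) ]
      (∀ y → ∃[ v ] f v ≡ y) × (∀ {b} → b ∈ˡ L → Respects Q f b) × n ≤ k + length L
    contraction [] = n , id , (λ y → y , refl) , (λ ()) , m≤m+n n 0
    contraction (b ∷ L) with contraction L
    ... | k , f , onto , resp , n≤ with f (tail b) ≟ f (head b)
    ...   | yes eq = k , f , onto , (λ { (here refl) → eq ; (there p) → resp p }) ,
      ≤-trans n≤ (+-monoʳ-≤ k (n≤1+n _))
    contraction (b ∷ L) | zero , f , _ | no _ = contradiction (f (tail b)) λ ()
    contraction (b ∷ L) | suc k , f , onto , resp , n≤ | no neq =
      k , merge ∘ f , merge-onto , merge-resp , ≤-trans n≤ (≤-reflexive (sym (+-suc k _)))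
      where
      i : Fin (suc k)
      i = f (tail b)
      -- The class of `tail b` is deleted and its vertices join the class of `head b`.
      merge : Fin (suc k) → Fin k
      merge x with i ≟ x
      ... | yes _  = punchOut neq
      ... | no i≢x = punchOut i≢x
      merge-onto : ∀ y → ∃[ v ] merge (f v) ≡ y
      merge-onto y with onto (punchIn i y)
      ... | v , fv≡ = v , trans (cong merge fv≡) section
        where
        section : merge (punchIn i y) ≡ y
        section with i ≟ punchIn i y
        ... | yes eq = contradiction (sym eq) (punchInᵢ≢i i y)
        ... | no i≢  = trans (punchOut-cong i refl) (punchOut-punchIn i)
      merge-resp : ∀ {c} → c ∈ˡ b ∷ L → Respects Q (merge ∘ f) c
      merge-resp (there p) = cong merge (resp p)
      merge-resp (here refl) with i ≟ i | i ≟ f (head b)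
      ... | no i≢i | _      = contradiction refl i≢i
      ... | yes _  | yes _  = refl
      ... | yes _  | no _   = punchOut-cong i refl

    -- Contract all arrows outside `B`. The quotient map is onto and, by hypothesis, constant, so at
    -- most one class is left, while the contracted arrows and `B` together are at most `d`.
    removable-bound : ∀ {B} → Unique B →
      (∀ {k} (f : Fin n → Fin k) → (∀ b → b ∉ B → Respects Q f b) → ∀ u v → f u ≡ f v) →
      n + length B ≤ suc d
    removable-bound {B} unique constant with contraction L
      where
      L : List (Fin d)
      L = filter (λ b → ¬? (_∈?_ _≟_ b B)) (allFin d)
    ... | k , f , onto , resp , n≤ = begin
      n + length B              ≤⟨ +-monoˡ-≤ (length B) n≤ ⟩
      k + length L + length B   ≡⟨ +-assoc k (length L) (length B) ⟩
      k + (length L + length B) ≡⟨ cong (k +_) (length-++ L) ⟨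
      k + length (L ++ B)
        ≤⟨ +-mono-≤ (k≤1 f onto (constant f resp′)) (Unique⇒length≤ (Unique.++⁺ uniqueL unique disjoint)) ⟩
      suc d                     ∎
      where
      open ≤-Reasoning
      L : List (Fin d)
      L = filter (λ b → ¬? (_∈?_ _≟_ b B)) (allFin d)
      uniqueL : Unique L
      uniqueL = Unique.filter⁺ (λ b → ¬? (_∈?_ _≟_ b B)) (Unique.allFin⁺ d)
      disjoint : ∀ {b} → ¬ (b ∈ˡ L × b ∈ˡ B)
      disjoint (p , q) = proj₂ (∈-filter⁻ (λ b → ¬? (_∈?_ _≟_ b B)) {xs = allFin d} p) q
      resp′ : ∀ b → b ∉ B → Respects Q f b
      resp′ b b∉B = resp (∈-filter⁺ (λ b → ¬? (_∈?_ _≟_ b B)) (∈-allFin b) b∉B)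
      k≤1 : ∀ {k} (f : Fin n → Fin k) → (∀ y → ∃[ v ] f v ≡ y) → (∀ u v → f u ≡ f v) → k ≤ 1
      k≤1 {zero}        _ _ _ = z≤n
      k≤1 {suc zero}    _ _ _ = s≤s z≤n
      k≤1 {suc (suc k)} f onto const with onto zero | onto (suc zero)
      ... | u , fu | v , fv with trans (sym fu) (trans (const u v) fv)
      ...   | ()

    -- The cut is the vertex set of one component, read off its spanning closed path so that
    -- membership is decidable. Arrows of the support stay within components. Without a second
    -- component, that closed path would make the support strongly connected.
    decomposable-cut : ∀ {μ} → Decomposable Q μ → Σ[ T ∈ Cut ]
      (∀ b → 1 ≤ μ b → Respects Q T b) × (∀ s → ∃[ b ] 1 ≤ μ b × T (head b) ≡ s)
    decomposable-cut {μ} ((b₀ , μb₀≢0) , ¬connected , k , S , connected , disjoint , (V⊆ , _) , (A⊆ , A⊇))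
      with A⊆ (n≢0⇒n>0 μb₀≢0)
    ... | i , b₀∈ = T , uncrossed , sides
      where
      open Subquiver
      h : ∀ j → Path Q
      h j = proj₁ (connected j)
      vertices : ∀ j → List (Fin n)
      vertices j = source (h j) ∷ List.map head (arrowList (h j))
      sound : ∀ j {v} → v ∈ V Q (h j) → v ∈ vertexSet (S j)
      sound j (here refl) = tail-closed (S j) (proj₁ (proj₂ (proj₂ (connected j))) (here refl))
      sound j (there q) with ∈-map⁻ head q
      ... | b , b∈ , refl = head-closed (S j) (proj₁ (proj₂ (proj₂ (connected j))) b∈)
      T : Cut
      T v = does (_∈?_ _≟_ v (vertices i))
      inside : ∀ {v} → v ∈ vertexSet (S i) → T v ≡ true
      inside p = dec-true (_∈?_ _≟_ _ (vertices i)) (proj₂ (proj₂ (proj₂ (connected i))) p)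
      outside : ∀ {j v} → j ≢ i → v ∈ vertexSet (S j) → T v ≡ false
      outside {j} j≢i p = dec-false (_∈?_ _≟_ _ (vertices i)) λ q → disjoint j i j≢i (p , sound i q)
      uncrossed : ∀ b → 1 ≤ μ b → Respects Q T b
      uncrossed b p with A⊆ p
      ... | j , b∈ with j ≟ i
      ...   | yes refl = trans (inside (tail-closed (S i) b∈)) (sym (inside (head-closed (S i) b∈)))
      ...   | no j≢i   = trans (outside j≢i (tail-closed (S j) b∈)) (sym (outside j≢i (head-closed (S j) b∈)))
      sides : ∀ s → ∃[ b ] 1 ≤ μ b × T (head b) ≡ s
      sides true = b₀ , n≢0⇒n>0 μb₀≢0 , inside (head-closed (S i) b₀∈)
      sides false with any? (λ j → ¬? (j ≟ i))
      ... | yes (j , j≢i) = b , A⊇ (j , b∈) , outside j≢i (head-closed (S j) b∈)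
        where
        b : Fin d
        b = List⁺.head (arrows (h j))
        b∈ : b ∈ arrowSet (S j)
        b∈ = proj₁ (proj₂ (proj₂ (connected j))) (here refl)
      ... | no only = contradiction spanning ¬connected
        where
        covered : ∀ {v} → v ∈ Subquiver.vertexSet (support Q μ) → v ∈ V Q (h i)
        covered p with V⊆ p
        ... | j , v∈ with j ≟ i
        ...   | yes refl = proj₂ (proj₂ (proj₂ (connected i))) v∈
        ...   | no j≢i   = contradiction (j , j≢i) only
        spanning : StronglyConnected Q (support Q μ)
        spanning = h i , proj₁ (proj₂ (connected i)) ,
          (λ p → A⊇ (i , proj₁ (proj₂ (proj₂ (connected i))) p)) , covered

    record Cycle : Set where
      field
        path        : Path Q
        closed      : Closed Q path
        uniqueHeads : UniqueHeads Q path

      circulation : Circulation Q (mdeg Q path)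
      circulation = mdeg-circulation Q path closed

      primitiveClosed : PrimitiveClosed Q path
      primitiveClosed = uniqueHeads⇒PrimitiveClosed Q path closed uniqueHeads

      -- The indicator of the vertex set, because the path is closed and its heads are distinct.
      visits : Vector ℕ n
      visits = inflow Q (mdeg Q path)

      visits≤1 : ∀ v → visits v ≤ 1
      visits≤1 v = subst (_≤ 1) (sym (inflow-mdeg Q path v)) (Unique⇒count≤1 uniqueHeads v)

      mdeg≤1 : ∀ b → mdeg Q path b ≤ 1
      mdeg≤1 b = ≤-trans (≤inflow Q (mdeg Q path) b) (visits≤1 (head b))

      sum-visits : sum visits ≡ degree path
      sum-visits = trans (sum-inflow Q (mdeg Q path)) (sum-mdeg Q path)

      visits-arrow : ∀ {v} → 1 ≤ visits v → ∃[ b ] b ∈ˡ arrowList path × head b ≡ v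
      visits-arrow p with inflow-positive Q (mdeg Q path) p
      ... | b , q , eq = b , ∈-count q , eq

      respects⇒onSide : ∀ (T : Cut) → (∀ {b} → b ∈ˡ arrowList path → Respects Q T b) →
        OnSide T (T (source path)) visits
      respects⇒onSide T resp v p with visits-arrow p
      ... | b , b∈ , refl = respects⇒constant Q T path resp b∈

    open Cycle

    flow : List Cycle → Multidegree d
    flow cs b = sumˡ (List.map (λ c → mdeg Q (path c) b) cs)

    flow-member : ∀ {c cs} → c ∈ˡ cs → ∀ b → mdeg Q (path c) b ≤ flow cs b
    flow-member (here refl) b = m≤m+n _ _
    flow-member (there p)   b = ≤-trans (flow-member p b) (m≤n+m _ _)

    flow-positive : ∀ cs {b} → 1 ≤ flow cs b → ∃[ c ] c ∈ˡ cs × 1 ≤ mdeg Q (path c) b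
    flow-positive (c ∷ cs) {b} p with mdeg Q (path c) b in eq
    ... | suc _ = c , here refl , subst (1 ≤_) (sym eq) (s≤s z≤n)
    ... | zero with flow-positive cs p
    ...   | c′ , c′∈ , q = c′ , there c′∈ , q

    sum-flow : ∀ cs → sum (flow cs) ≡ total (List.map visits cs)
    sum-flow []       = sum-zero d
    sum-flow (c ∷ cs) = trans (∑-distrib-+ (mdeg Q (path c)) (flow cs))
      (cong₂ _+_ (sym (sum-inflow Q (mdeg Q (path c)))) (sum-flow cs))

    -- By the field lost, subtracting 2 mdeg c from any σ ≤ δ removes the crossing arrow
    -- from the support of σ.
    record CutOf (δ : Multidegree d) (c : Cycle) : Set where
      field
        T         : Cut
        crossing  : Fin d
        crossing∈ : crossing ∈ˡ arrowList (path c)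
        lost      : δ crossing ≤ 2 * mdeg Q (path c) crossing
        crossed   : ¬ Respects Q T crossing
        uncrossed : ∀ b → 1 ≤ δ b ∸ 2 * mdeg Q (path c) b → Respects Q T b
        sides     : ∀ s → ∃[ b ] 1 ≤ δ b ∸ 2 * mdeg Q (path c) b × T (head b) ≡ s

    open CutOf

    module _ {δ : Multidegree d} (positive : ∀ b → 1 ≤ δ b)
      (connected : ∀ (T : Cut) → (∀ b → Respects Q T b) → ∀ u v → T u ≡ T v) where

      -- If no arrow crossed `T`, connectedness would make `T` constant, although the remainder has
      -- arrows on both sides. A crossing arrow is absent from the remainder, and as `δ` is positive
      -- on it, it must lie on `c`.
      cutOf : ∀ c → Decomposable Q (λ b → δ b ∸ 2 * mdeg Q (path c) b) → CutOf δ c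
      cutOf c dec with decomposable-cut dec
      ... | T , unc , sds with any? (λ b → ¬? (T (tail b) Bool.≟ T (head b)))
      ...   | yes (b , cross) = record
        { T = T
        ; crossing = b
        ; crossing∈ = ∈-count 1≤mdeg
        ; lost = lost′
        ; crossed = cross
        ; uncrossed = unc
        ; sides = sds
        }
        where
        lost′ : δ b ≤ 2 * mdeg Q (path c) b
        lost′ with δ b ≤? 2 * mdeg Q (path c) b
        ... | yes le = le
        ... | no nle = contradiction (unc b (m<n⇒0<n∸m (≰⇒> nle))) cross
        1≤mdeg : 1 ≤ mdeg Q (path c) b
        1≤mdeg with mdeg Q (path c) b | ≤-trans (positive b) lost′
        ... | suc _ | _ = s≤s z≤n
      ...   | no none with sds true | sds false
      ...     | b , _ , eq | b′ , _ , eq′ with trans (sym eq) (trans (connected T resp (head b) (head b′)) eq′)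
        where
        resp : ∀ b → Respects Q T b
        resp b with T (tail b) Bool.≟ T (head b)
        ... | yes p = p
        ... | no ¬p = contradiction (b , ¬p) none
      ...       | ()

    record Decomposition (δ σ : Multidegree d) : Set where
      field
        as      : List (Σ[ c ∈ Cycle ] CutOf δ c)
        cs      : List Cycle
        flow≗   : σ ≗ λ b → 2 * flow (List.map proj₁ as) b + flow cs b
        -- One arrow of the support exhausted by each subtracted cycle.
        B       : List (Fin d)
        B-length : length B ≡ length as + length cs
        B-unique : Unique B
        B-supp   : ∀ {b} → b ∈ˡ B → 1 ≤ σ b
        -- Deleting `B` from the support of `σ` does not change the connected components.
        B-redundant : ∀ {k} (f : Fin n → Fin k) → (∀ b → 1 ≤ σ b → b ∉ B → Respects Q f b) →
                      ∀ b → 1 ≤ σ b → Respects Q f b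

    open Decomposition

    module _ {δ : Multidegree d} (cut : ∀ c → Double Q δ (path c) → CutOf δ c) where

      -- Both kinds of subtraction at once: `suc j` is 2 for a double cycle and 1 otherwise, hence
      -- never zero.
      module _ {σ} (circ : Circulation Q σ) (c : Cycle) j (j≤ : ∀ {b} → b ∈ˡ arrowList (path c) → suc j ≤ σ b) where

        rest : Multidegree d
        rest b = σ b ∸ suc j * mdeg Q (path c) b

        removable : ∀ b → suc j * mdeg Q (path c) b ≤ σ b
        removable b with mdeg Q (path c) b in eq | mdeg≤1 c b
        ... | zero        | _ = subst (_≤ σ b) (sym (*-zeroʳ j)) z≤n
        ... | suc zero    | _ = subst (_≤ σ b) (sym (*-identityʳ (suc j))) (j≤ (∈-count (subst (1 ≤_) (sym eq) (s≤s z≤n))))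
        ... | suc (suc _) | s≤s ()

        rest≤σ : ∀ b → rest b ≤ σ b
        rest≤σ b = m∸n≤m (σ b) (suc j * mdeg Q (path c) b)

        rest-circulation : Circulation Q rest
        rest-circulation = Circulation-∸ Q circ (Circulation-* Q (suc j) {mdeg Q (path c)} (circulation c)) removable

        -- The first arrow of `c` loses at least one unit, so the total that bounds the recursion
        -- drops.
        rest-sum : ∀ {N} → sum σ ≤ suc N → sum rest ≤ N
        rest-sum {N} σ≤ = s≤s⁻¹ (begin
          suc (sum rest)                                         ≡⟨ +-comm 1 (sum rest) ⟩
          sum rest + 1                                           ≤⟨ +-monoʳ-≤ (sum rest) 1≤removed ⟩
          sum rest + sum (λ b → suc j * mdeg Q (path c) b)       ≡⟨ sum-∸ removable ⟩
          sum σ                                                  ≤⟨ σ≤ ⟩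
          suc N                                                  ∎)
          where
          open ≤-Reasoning
          1≤removed : 1 ≤ sum (λ b → suc j * mdeg Q (path c) b)
          1≤removed = ≤-trans (count-∈ {l = arrowList (path c)} (here refl))
            (≤-trans (m≤m+n _ _) (term≤sum (λ b → suc j * mdeg Q (path c) b) (List⁺.head (arrows (path c)))))

        module _ {b₀} (b₀∈ : b₀ ∈ˡ arrowList (path c)) (killed : σ b₀ ≤ suc j * mdeg Q (path c) b₀)
          (D : Decomposition δ rest) where

          rest≤ : ∀ {b} → 1 ≤ rest b → 1 ≤ σ b
          rest≤ p = ≤-trans p (rest≤σ _)

          survives : ∀ {b} → 1 ≤ rest b → b ≢ b₀
          survives p refl = contradiction (subst (1 ≤_) (m≤n⇒m∸n≡0 killed) p) λ ()

          b₀-supp : 1 ≤ σ b₀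
          b₀-supp = ≤-trans (s≤s z≤n) (j≤ b₀∈)

          unique₁ : Unique (b₀ ∷ B D)
          unique₁ = ¬Any⇒All¬ (B D) (λ p → survives (B-supp D p) refl) ∷ B-unique D

          supp₁ : ∀ {b} → b ∈ˡ b₀ ∷ B D → 1 ≤ σ b
          supp₁ (here refl) = b₀-supp
          supp₁ (there p)   = rest≤ (B-supp D p)

          module _ {k} (f : Fin n → Fin k) (resp : ∀ b → 1 ≤ σ b → b ∉ b₀ ∷ B D → Respects Q f b) where

            rest-respects : ∀ b → 1 ≤ rest b → Respects Q f b
            rest-respects = B-redundant D f λ b p b∉ →
              resp b (rest≤ p) λ { (here eq) → survives p eq ; (there q) → b∉ q }

            others-respect : ∀ b → 1 ≤ σ b → b ≢ b₀ → Respects Q f b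
            others-respect b p b≢b₀ with _∈?_ _≟_ b (B D)
            ... | yes q = rest-respects b (B-supp D q)
            ... | no ∉B = resp b p λ { (here eq) → b≢b₀ eq ; (there q) → ∉B q }

            -- The arrows other than `b₀` are settled by the hypothesis or by the decomposition of
            -- `rest`. A circulation cannot cross a level set of `f` along `b₀` alone, so `b₀`
            -- follows.
            redundant₁ : ∀ b → 1 ≤ σ b → Respects Q f b
            redundant₁ b p with b ≟ b₀
            ... | yes refl = respects-last Q circ f b₀ others-respect p
            ... | no b≢b₀  = others-respect b p b≢b₀

      addDouble : ∀ {σ} (circ : Circulation Q σ) (c : Cycle) (2≤ : ∀ {b} → b ∈ˡ arrowList (path c) → 2 ≤ σ b)
        (K : CutOf δ c) → σ (crossing K) ≤ 2 * mdeg Q (path c) (crossing K) →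
        Decomposition δ (rest circ c 1 2≤) → Decomposition δ σ
      addDouble {σ} circ c 2≤ K killed D = record
        { as = (c , K) ∷ as D
        ; cs = cs D
        ; flow≗ = λ b → trans (sym (m∸n+n≡m (removable circ c 1 2≤ b)))
            (trans (cong (_+ 2 * mdeg Q (path c) b) (flow≗ D b))
              (solve 3 (λ x a r → con 2 :* a :+ r :+ con 2 :* x := con 2 :* (x :+ a) :+ r) refl
                (mdeg Q (path c) b) (flow (List.map proj₁ (as D)) b) (flow (cs D) b)))
        ; B = crossing K ∷ B D
        ; B-length = cong suc (B-length D)
        ; B-unique = unique₁ circ c 1 2≤ (crossing∈ K) killed D
        ; B-supp = supp₁ circ c 1 2≤ (crossing∈ K) killed D
        ; B-redundant = redundant₁ circ c 1 2≤ (crossing∈ K) killed D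
        }
        where open +-*-Solver

      addSingle : ∀ {σ} (circ : Circulation Q σ) (c : Cycle) (1≤ : ∀ {b} → b ∈ˡ arrowList (path c) → 1 ≤ σ b)
        {b₀} (b₀∈ : b₀ ∈ˡ arrowList (path c)) → σ b₀ ≤ 1 * mdeg Q (path c) b₀ →
        Decomposition δ (rest circ c 0 1≤) → Decomposition δ σ
      addSingle {σ} circ c 1≤ {b₀} b₀∈ killed D = record
        { as = as D
        ; cs = c ∷ cs D
        ; flow≗ = λ b → trans (sym (m∸n+n≡m (removable circ c 0 1≤ b)))
            (trans (cong (_+ 1 * mdeg Q (path c) b) (flow≗ D b))
              (solve 3 (λ x a r → con 2 :* a :+ r :+ con 1 :* x := con 2 :* a :+ (x :+ r)) refl
                (mdeg Q (path c) b) (flow (List.map proj₁ (as D)) b) (flow (cs D) b)))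
        ; B = b₀ ∷ B D
        ; B-length = trans (cong suc (B-length D)) (sym (+-suc (length (as D)) _))
        ; B-unique = unique₁ circ c 0 1≤ b₀∈ killed D
        ; B-supp = supp₁ circ c 0 1≤ b₀∈ killed D
        ; B-redundant = redundant₁ circ c 0 1≤ b₀∈ killed D
        }
        where open +-*-Solver

      decompose : ∀ N {σ} → sum σ ≤ N → Circulation Q σ → (∀ b → σ b ≤ δ b) → Decomposition δ σ
      decompose N {σ} σ≤N circ σ≤δ with any? (λ b → 1 ≤? σ b)
      ... | no none = record
        { as = []
        ; cs = []
        ; flow≗ = λ b → n<1⇒n≡0 (≰⇒> λ p → none (b , p))
        ; B = []
        ; B-length = refl
        ; B-unique = []
        ; B-supp = λ ()
        ; B-redundant = λ f _ b p → contradiction (b , p) none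
        }
      decompose zero {σ} σ≤N circ σ≤δ | yes (b , p) = contradiction (≤-trans p (≤-trans (term≤sum σ b) σ≤N)) λ ()
      decompose (suc N) {σ} σ≤N circ σ≤δ | yes (b , p) with findCycle Q circ b p
      ... | h , closed , unique , supp with all? (λ b → 2 ≤? σ b) (arrowList h)
      -- As `σ ≤ δ`, a `σ`-double cycle is also `δ`-double and so has a cut; the bound `lost` on `δ`
      -- passes to `σ`, so the crossing arrow is exhausted.
      ...   | yes 2≤ = addDouble circ c (All.lookup 2≤) K (≤-trans (σ≤δ _) (lost K))
        (decompose N (rest-sum circ c 1 (All.lookup 2≤) σ≤N) (rest-circulation circ c 1 (All.lookup 2≤))
          λ b → ≤-trans (rest≤σ circ c 1 (All.lookup 2≤) b) (σ≤δ b))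
        where
        c : Cycle
        c = record { path = h ; closed = closed ; uniqueHeads = unique }
        K : CutOf δ c
        K = cut c (primitiveClosed c , λ b∈ → ≤-trans (All.lookup 2≤ b∈) (σ≤δ _))
      ...   | no ¬2≤ with find (¬All⇒Any¬ (λ b → 2 ≤? σ b) (arrowList h) ¬2≤)
      -- `σ b₀` is at most one and `b₀` lies on the cycle, so a single subtraction exhausts it.
      ...     | b₀ , b₀∈ , ¬2≤σ = addSingle circ c (All.lookup supp) b₀∈
        (≤-trans (s≤s⁻¹ (≰⇒> ¬2≤σ)) (≤-trans (count-∈ b₀∈) (m≤m+n _ 0)))
        (decompose N (rest-sum circ c 0 (All.lookup supp) σ≤N) (rest-circulation circ c 0 (All.lookup supp))
          λ b → ≤-trans (rest≤σ circ c 0 (All.lookup supp) b) (σ≤δ b))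
        where
        c : Cycle
        c = record { path = h ; closed = closed ; uniqueHeads = unique }

  -- The family of cycles of a decomposition

  module _ {n d : ℕ} (Q : Quiver n d) where
    open Quiver Q
    open Path
    open Cycle
    open CutOf
    open Decomposition

    CutCycle : Multidegree d → Set
    CutCycle δ = Σ[ c ∈ Cycle Q ] CutOf Q δ c

    tagged : ∀ {δ} → CutCycle δ → Vector ℕ n × Cut
    tagged (c , K) = visits c , T K

    cycles : ∀ {δ} → List (CutCycle δ) → List (Cycle Q) → List (Cycle Q)
    cycles as cs = List.map proj₁ as ++ cs

    members-cycles : ∀ {δ} (as : List (CutCycle δ)) cs →
      members (List.map tagged as) (List.map visits cs) ≡ List.map visits (cycles as cs)
    members-cycles []       cs = refl
    members-cycles (a ∷ as) cs = cong (_ ∷_) (members-cycles as cs)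

    total-members : ∀ {δ} (as : List (CutCycle δ)) cs →
      total (members (List.map tagged as) (List.map visits cs)) ≡
      sum (flow Q (List.map proj₁ as)) + sum (flow Q cs)
    total-members as cs = begin
      total (members (List.map tagged as) (List.map visits cs)) ≡⟨ cong total (members-cycles as cs) ⟩
      total (List.map visits (cycles as cs))                    ≡⟨ sum-flow Q (cycles as cs) ⟨
      sum (flow Q (cycles as cs))
        ≡⟨ sum-cong-≗ (λ b → flow-++ (List.map proj₁ as) cs b) ⟩
      sum (λ b → flow Q (List.map proj₁ as) b + flow Q cs b)
        ≡⟨ ∑-distrib-+ (flow Q (List.map proj₁ as)) (flow Q cs) ⟩
      sum (flow Q (List.map proj₁ as)) + sum (flow Q cs)        ∎
      where
      open ≡-Reasoning
      flow-++ : ∀ xs ys b → flow Q (xs ++ ys) b ≡ flow Q xs b + flow Q ys b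
      flow-++ xs ys b = trans (cong sumˡ (map-++ (λ c → mdeg Q (path c) b) xs ys))
        (sum-++ (List.map (λ c → mdeg Q (path c) b) xs) _)

    combination-positive : ∀ xs ys {b} → 1 ≤ 2 * flow Q xs b + flow Q ys b →
      ∃[ c ] c ∈ˡ xs ++ ys × 1 ≤ mdeg Q (path c) b
    combination-positive xs ys {b} p with flow Q xs b in eq
    ... | suc _ with flow-positive Q xs (subst (1 ≤_) (sym eq) (s≤s z≤n))
    ...   | c , c∈ , q = c , ∈-++⁺ˡ c∈ , q
    combination-positive xs ys p | zero with flow-positive Q ys p
    ... | c , c∈ , q = c , ∈-++⁺ʳ xs c∈ , q

    module _ {m} (bounded : ∀ p → PrimitiveClosed Q p → degree p ≤ m) where

      sum-flow-bound : ∀ cs → sum (flow Q cs) ≤ m * length cs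
      sum-flow-bound cs = ≤-trans (≤-reflexive (sum-flow Q cs))
        (≤-trans (total-bound (List.map visits cs) bound) (≤-reflexive (cong (m *_) (length-map visits cs))))
        where
        bound : ∀ {x} → x ∈ˡ List.map visits cs → sum x ≤ m
        bound p with ∈-map⁻ visits p
        ... | c , _ , refl = ≤-trans (≤-reflexive (sum-visits c)) (bounded (path c) (primitiveClosed c))

      module _ {δ} (h : Path Q) (h-all : ∀ b → b ∈ˡ arrowList h)
        (h-vertices : ∀ v → V Q h v) (δ≗ : δ ≗ mdeg Q h) where

        positive : ∀ b → 1 ≤ δ b
        positive b = ≤-trans (count-∈ (h-all b)) (≤-reflexive (sym (δ≗ b)))

        constant : ∀ {C : Set} (f : Fin n → C) → (∀ b → Respects Q f b) → ∀ v → f v ≡ f (source h)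
        constant f resp v with h-vertices v
        ... | here refl = refl
        ... | there p with ∈-map⁻ head p
        ...   | b , b∈ , refl = respects⇒constant Q f h (λ {b} _ → resp b) b∈

        module _ (D : Decomposition Q δ δ) where

          module _ {c K as₀} (as↭ : as D ↭ (c , K) ∷ as₀) where

            others : Multidegree d
            others b = 2 * flow Q (List.map proj₁ as₀) b + flow Q (cs D) b

            others≡ : ∀ b → δ b ∸ 2 * mdeg Q (path c) b ≡ others b
            others≡ b = trans (cong (_∸ 2 * x) (trans (flow≗ D b) (trans
                (cong (λ z → 2 * z + flow Q (cs D) b) (sum-↭ (map⁺ (λ c → mdeg Q (path c) b) (map⁺ proj₁ as↭))))
                (solve 3 (λ x a r → con 2 :* (x :+ a) :+ r := (con 2 :* a :+ r) :+ con 2 :* x) refl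
                  x (flow Q (List.map proj₁ as₀) b) (flow Q (cs D) b)))))
              (m+n∸n≡m (others b) (2 * x))
              where
              open +-*-Solver
              x : ℕ
              x = mdeg Q (path c) b

            -- What remains of `δ` after removing `c` twice is the combination of all other cycles,
            -- so each of their arrows lies in its support, where nothing crosses the cut of `c`.
            member⇒uncrossed : ∀ {c′} → c′ ∈ˡ cycles as₀ (cs D) → ∀ {b} → b ∈ˡ arrowList (path c′) → Respects Q (T K) b
            member⇒uncrossed {c′} p {b} b∈ = uncrossed K b (subst (1 ≤_) (sym (others≡ b)) (≤-trans (count-∈ b∈) mdeg≤))
              where
              mdeg≤ : mdeg Q (path c′) b ≤ others b
              mdeg≤ with ∈-++⁻ (List.map proj₁ as₀) p
              ... | inj₁ q = ≤-trans (flow-member Q q b) (≤-trans (m≤m+n _ _) (m≤m+n _ _))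
              ... | inj₂ q = ≤-trans (flow-member Q q b) (m≤n+m _ _)

            member-onSide : ∀ {c′} → c′ ∈ˡ cycles as₀ (cs D) → OnSide (T K) (T K (source (path c′))) (visits c′)
            member-onSide {c′} p = respects⇒onSide c′ (T K) (member⇒uncrossed p)

            -- An arrow of the remainder on side `s` lies on one of the other cycles, and this
            -- cycle, being uncut, is on side `s` entirely.
            onBothSides : ∀ s → ∃[ c′ ] c′ ∈ˡ cycles as₀ (cs D) × Nonzero (visits c′) × OnSide (T K) s (visits c′)
            onBothSides s with sides K s
            ... | b , p , refl = c′ , c′∈ , (head b , visited) ,
              λ v q → trans (member-onSide c′∈ v q) (sym (member-onSide c′∈ (head b) visited))
              where
              through : ∃[ c′ ] c′ ∈ˡ cycles as₀ (cs D) × 1 ≤ mdeg Q (path c′) b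
              through = combination-positive (List.map proj₁ as₀) (cs D) (subst (1 ≤_) (others≡ b) p)
              c′ : Cycle Q
              c′ = proj₁ through
              c′∈ : c′ ∈ˡ cycles as₀ (cs D)
              c′∈ = proj₁ (proj₂ through)
              visited : 1 ≤ visits c′ (head b)
              visited = ≤-trans (proj₂ (proj₂ through)) (≤inflow Q (mdeg Q (path c′)) b)

            crossedBy : Crosses (T K) (visits c)
            crossedBy s with T K (tail (crossing K)) Bool.≟ s
            ... | yes eq =
              tail (crossing K) , tail-positive Q {mdeg Q (path c)} (circulation c) (count-∈ (crossing∈ K)) , eq
            ... | no neq =
              head (crossing K) , ≤-trans (count-∈ (crossing∈ K)) (≤inflow Q (mdeg Q (path c)) _) ,
              trans (Bool.¬-not (λ eq → crossed K (sym eq))) (trans (cong not (Bool.¬-not neq)) (Bool.not-involutive s))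

          as′ : List (Vector ℕ n × Cut)
          as′ = List.map tagged (as D)

          cs′ : List (Vector ℕ n)
          cs′ = List.map visits (cs D)

          cycle⁻ : ∀ {x} (as₀ : List (CutCycle δ)) → x ∈ˡ members (List.map tagged as₀) cs′ →
            ∃[ c ] c ∈ˡ cycles as₀ (cs D) × x ≡ visits c
          cycle⁻ as₀ p = ∈-map⁻ visits (subst (_ ∈ˡ_) (members-cycles as₀ (cs D)) p)

          cycle⁺ : ∀ {c} (as₀ : List (CutCycle δ)) → c ∈ˡ cycles as₀ (cs D) →
            visits c ∈ˡ members (List.map tagged as₀) cs′
          cycle⁺ as₀ p = subst (_ ∈ˡ_) (sym (members-cycles as₀ (cs D))) (∈-map⁺ visits p)

          through : ∀ b → ∃[ c ] c ∈ˡ cycles (as D) (cs D) × 1 ≤ mdeg Q (path c) b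
          through b = combination-positive (List.map proj₁ (as D)) (cs D) (subst (1 ≤_) (flow≗ D b) (positive b))

          cycleFamily : 1 ≤ length (as D) ⊎ 2 ≤ length (cs D) → Family m (λ _ → 1) as′ cs′
          cycleFamily large = record
            { inside = λ p → inside′ p
            ; bounded = λ p → bounded′ p
            ; connected = connected′
            ; crosses = λ p → crosses′ p
            ; uncut = λ p q → uncut′ p q
            ; sides = λ p → sides′ p
            ; large = large′
            }
            where
            inside′ : ∀ {x} → x ∈ˡ members as′ cs′ → ∀ v → x v ≤ 1
            inside′ p v with cycle⁻ (as D) p
            ... | c , _ , refl = visits≤1 c v
            bounded′ : ∀ {x} → x ∈ˡ members as′ cs′ → sum x ≤ m
            bounded′ p with cycle⁻ (as D) p
            ... | c , _ , refl = ≤-trans (≤-reflexive (sum-visits c)) (bounded (path c) (primitiveClosed c))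
            connected′ : ∀ X → (∀ {x} → x ∈ˡ members as′ cs′ → Uncut X x) →
              ∃[ s ] (∀ {x} → x ∈ˡ members as′ cs′ → OnSide X s x)
            -- Every arrow lies on some cycle, so a cut that no cycle crosses is respected by all
            -- arrows and is constant along `h`.
            connected′ X X-uncut = X (source h) , λ _ v _ → constant X resp v
              where
              resp : ∀ b → Respects Q X b
              resp b with through b
              ... | c , c∈ , p with X-uncut (cycle⁺ (as D) c∈)
              ...   | s , side = trans (side (tail b) (tail-positive Q {mdeg Q (path c)} (circulation c) p))
                (sym (side (head b) (≤-trans p (≤inflow Q (mdeg Q (path c)) b))))
            crosses′ : ∀ {a S as″} → as′ ↭ (a , S) ∷ as″ → Crosses S a
            crosses′ p with ↭-map-inv tagged p
            ... | (c , K) ∷ as₀ , refl , q = crossedBy q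
            uncut′ : ∀ {a S as″} → as′ ↭ (a , S) ∷ as″ → ∀ {x} → x ∈ˡ members as″ cs′ → Uncut S x
            uncut′ p x∈ with ↭-map-inv tagged p
            ... | (c , K) ∷ as₀ , refl , q with cycle⁻ as₀ x∈
            ...   | c′ , c′∈ , refl = _ , member-onSide q c′∈
            sides′ : ∀ {a S as″} → as′ ↭ (a , S) ∷ as″ → ∀ s → ∃[ x ] x ∈ˡ members as″ cs′ × Nonzero x × OnSide S s x
            sides′ p s with ↭-map-inv tagged p
            ... | (c , K) ∷ as₀ , refl , q with onBothSides q s
            ...   | c′ , c′∈ , nonzero , side = visits c′ , cycle⁺ as₀ c′∈ , nonzero , side
            large′ : 1 ≤ length as′ ⊎ 2 ≤ length cs′
            large′ = subst₂ (λ x y → 1 ≤ x ⊎ 2 ≤ y)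
              (sym (length-map tagged (as D))) (sym (length-map visits (cs D))) large

          α γ : ℕ
          α = sum (flow Q (List.map proj₁ (as D)))
          γ = sum (flow Q (cs D))

          few-or-large : ∀ {a b} {X : Set a} {Y : Set b} (xs : List X) (ys : List Y) →
            (1 ≤ length xs ⊎ 2 ≤ length ys) ⊎ xs ≡ [] × (ys ≡ [] ⊎ (∃[ y ] ys ≡ y ∷ []))
          few-or-large (_ ∷ _) _           = inj₁ (inj₁ (s≤s z≤n))
          few-or-large [] []               = inj₂ (refl , inj₁ refl)
          few-or-large [] (y ∷ [])         = inj₂ (refl , inj₂ (y , refl))
          few-or-large [] (_ ∷ _ ∷ _)      = inj₁ (inj₂ (s≤s (s≤s z≤n)))

          -- Here each double cycle counts once. `cycleFamily` needs a cut or two cycles; otherwise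
          -- there is no cycle, which is impossible since every arrow lies on one, or a single cycle
          -- with at most `n` vertices, where `m ≤ n` suffices.
          visits-bound : m ≤ n → α + γ + 2 * m ≤ m * length (cs D) + 2 * n
          visits-bound m≤n with few-or-large (as D) (cs D)
          ... | inj₁ large = begin
            α + γ + 2 * m                             ≡⟨ cong (_+ 2 * m) (total-members (as D) (cs D)) ⟨
            total (members as′ cs′) + 2 * m
              ≤⟨ family-bound (length as′) ≤-refl (cycleFamily large) ⟩
            m * length cs′ + 2 * sum {n} (λ _ → 1)
              ≡⟨ cong₂ (λ x y → m * x + 2 * y) (length-map visits (cs D)) (sum-one n) ⟩
            m * length (cs D) + 2 * n                 ∎
            where open ≤-Reasoning
          ... | inj₂ (as≡[] , inj₁ cs≡[]) with through (List⁺.head (arrows h))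
          ...   | c , c∈ , _ = contradiction (subst₂ (λ x y → c ∈ˡ cycles x y) as≡[] cs≡[] c∈) λ ()
          visits-bound m≤n | inj₂ (as≡[] , inj₂ (c , cs≡[c])) rewrite as≡[] | cs≡[c] = begin
            sum {d} (λ _ → 0) + sum (flow Q (c ∷ [])) + 2 * m
              ≡⟨ cong (λ z → z + sum (flow Q (c ∷ [])) + 2 * m) (sum-zero d) ⟩
            sum (flow Q (c ∷ [])) + 2 * m                      ≡⟨ cong (_+ 2 * m) (sum-flow Q (c ∷ [])) ⟩
            sum (visits c) + 0 + 2 * m
              ≤⟨ +-monoˡ-≤ (2 * m) (+-monoˡ-≤ 0 (≤-trans (sum-mono (visits≤1 c)) (≤-reflexive (sum-one n)))) ⟩
            n + 0 + 2 * m
              ≡⟨ solve 2 (λ n m → n :+ con 0 :+ con 2 :* m := n :+ (m :+ m)) refl n m ⟩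
            n + (m + m)                                        ≤⟨ +-monoʳ-≤ n (+-monoʳ-≤ m m≤n) ⟩
            n + (m + n)
              ≡⟨ solve 2 (λ n m → n :+ (m :+ n) := m :* con 1 :+ con 2 :* n) refl n m ⟩
            m * 1 + 2 * n                                      ∎
            where
            open ≤-Reasoning
            open +-*-Solver

          -- The second copy of each double cycle costs at most `m`, which puts `as` and `cs` on an
          -- equal footing.
          degree-bound : m ≤ n → sum δ + 2 * m ≤ m * length (B D) + 2 * n
          degree-bound m≤n = begin
            sum δ + 2 * m                                         ≡⟨ cong (_+ 2 * m) sumδ ⟩
            2 * α + γ + 2 * m
              ≡⟨ solve 3 (λ a c m → con 2 :* a :+ c :+ con 2 :* m := a :+ (a :+ c :+ con 2 :* m)) refl α γ m ⟩
            α + (α + γ + 2 * m)                                   ≤⟨ +-mono-≤ α≤ (visits-bound m≤n) ⟩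
            m * length (as D) + (m * length (cs D) + 2 * n)
              ≡⟨ solve 4 (λ m a c n → m :* a :+ (m :* c :+ con 2 :* n) := m :* (a :+ c) :+ con 2 :* n) refl m (length (as D)) (length (cs D)) n ⟩
            m * (length (as D) + length (cs D)) + 2 * n
              ≡⟨ cong (λ z → m * z + 2 * n) (B-length D) ⟨
            m * length (B D) + 2 * n                              ∎
            where
            open ≤-Reasoning
            open +-*-Solver
            sumδ : sum δ ≡ 2 * α + γ
            sumδ = trans (sum-cong-≗ (flow≗ D))
              (trans (∑-distrib-+ (λ b → 2 * flow Q (List.map proj₁ (as D)) b) (flow Q (cs D)))
                (cong (_+ γ) (sym (*-distribˡ-sum 2 (flow Q (List.map proj₁ (as D)))))))
            α≤ : α ≤ m * length (as D)
            α≤ = ≤-trans (sum-flow-bound (List.map proj₁ (as D))) (≤-reflexive (cong (m *_) (length-map proj₁ (as D))))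

          removed-bound : n + length (B D) ≤ suc d
          removed-bound = removable-bound Q (B-unique D) λ f resp u v →
            let resp′ = λ b → B-redundant D f (λ b _ → resp b) b (positive b)
            in trans (constant f resp′ u) (sym (constant f resp′ v))

    Ω₂-bound : ∀ {m} → Q ∈ 𝒬 n d m → ∀ {δ} → δ ∈ Ω₂ Q →
      ∃[ N ] sum δ + 2 * m ≤ m * N + 2 * n × n + N ≤ suc d
    Ω₂-bound {m} ((g , g-closed , _ , g-vertices) , (p , p-closed , degree≡m) , bounded)
      {δ} ((h , h-closed , h-all , δ≗) , double) =
      length (B D) , degree-bound bounded h h-all h-vertices δ≗ D m≤n ,
      removed-bound bounded h h-all h-vertices δ≗ D
      where
      -- By strong connectedness every vertex is the head of an arrow, and `h` contains all arrows.
      h-vertices : ∀ v → V Q h v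
      h-vertices v with g-vertices {v} _
      ... | here refl = subst (V Q h) (sym g-closed) (there (∈-map⁺ head (h-all _)))
      ... | there q with ∈-map⁻ head q
      ...   | b , _ , refl = there (∈-map⁺ head (h-all b))
      m≤n : m ≤ n
      m≤n = subst (_≤ n) degree≡m (PrimitiveClosed⇒degree≤n Q p p-closed)
      pos : ∀ b → 1 ≤ δ b
      pos = positive bounded h h-all h-vertices δ≗
      cut : ∀ c → Double Q δ (path c) → CutOf Q δ c
      cut c dbl = cutOf Q pos
        (λ T resp u v → trans (constant bounded h h-all h-vertices δ≗ T resp u)
                              (sym (constant bounded h h-all h-vertices δ≗ T resp v)))
        c (double (path c) dbl)
      δ-circulation : Circulation Q δ
      δ-circulation φ = trans (sum-cong-≗ λ b → cong (_* φ (head b)) (δ≗ b))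
        (trans (mdeg-circulation Q h h-closed φ) (sum-cong-≗ λ b → cong (_* φ (tail b)) (sym (δ≗ b))))
      D : Decomposition Q δ δ
      D = decompose Q cut (sum δ) ≤-refl δ-circulation (λ b → ≤-refl)

-- Passage to the integers

open import Data.Nat.Base using (ℕ)
open import Data.Integer.Base using (+_; _+_; _*_; _-_; _≤_)
open import Relation.Unary using (_∈_)

module _ where
  import Data.Nat.Base as ℕ
  import Data.Nat.Properties as ℕ
  open import Data.Integer.Base using (+≤+; 1ℤ; -_)
  open import Data.Integer.Properties using (pos-*; +-monoˡ-≤; module ≤-Reasoning)
  open import Data.Integer.Solver using (module +-*-Solver)
  open import Data.Product.Base using (∃-syntax; _×_; _,_)
  open import Relation.Binary.PropositionalEquality using (_≡_; refl; sym; trans; cong; cong₂)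

  to-integers : ∀ s n d m →
    ∃[ N ] s ℕ.+ 2 ℕ.* m ℕ.≤ m ℕ.* N ℕ.+ 2 ℕ.* n × n ℕ.+ N ℕ.≤ ℕ.suc d →
    + s ≤ + m * (+ d - + n - + 1) + + 2 * + n
  to-integers s n d m (N , s≤ , N≤) = begin
    + s
      ≡⟨ solve 2 (λ s m → s := s :+ con (+ 2) :* m :- con (+ 2) :* m) refl (+ s) (+ m) ⟩
    + s + + 2 * + m - + 2 * + m
      ≡⟨ cong (λ z → + s + z - + 2 * + m) (sym (pos-* 2 m)) ⟩
    + (s ℕ.+ 2 ℕ.* m) - + 2 * + m                        ≤⟨ +-monoˡ-≤ (- (+ 2 * + m)) (+≤+ s≤′) ⟩
    + (m ℕ.* M ℕ.+ 2 ℕ.* n) - + 2 * + m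
      ≡⟨ cong (_- + 2 * + m) (cong₂ _+_ (pos-* m M) (pos-* 2 n)) ⟩
    + m * + M + + 2 * + n - + 2 * + m
      ≡⟨ solve 3 (λ m M n → m :* M :+ con (+ 2) :* n :- con (+ 2) :* m :=
      m :* (n :+ M :- con 1ℤ :- n :- con 1ℤ) :+ con (+ 2) :* n) refl (+ m) (+ M) (+ n) ⟩
    + m * (+ n + + M - + 1 - + n - + 1) + + 2 * + n
      ≡⟨ cong (λ z → + m * (z - + n - + 1) + + 2 * + n) (sym d≡) ⟩
    + m * (+ d - + n - + 1) + + 2 * + n                  ∎
    where
    open ≤-Reasoning
    open +-*-Solver
    -- The largest value that `N` may take. Then `d - n - 1` equals `M - 2`, which accounts for the
    -- term `2 * m`.
    M : ℕ
    M = ℕ.suc d ℕ.∸ n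
    n+M≡ : n ℕ.+ M ≡ ℕ.suc d
    n+M≡ = ℕ.m+[n∸m]≡n (ℕ.≤-trans (ℕ.m≤m+n n N) N≤)
    N≤M : N ℕ.≤ M
    N≤M = ℕ.m+n≤o⇒m≤o∸n N (ℕ.≤-trans (ℕ.≤-reflexive (ℕ.+-comm N n)) N≤)
    s≤′ : s ℕ.+ 2 ℕ.* m ℕ.≤ m ℕ.* M ℕ.+ 2 ℕ.* n
    s≤′ = ℕ.≤-trans s≤ (ℕ.+-monoˡ-≤ (2 ℕ.* n) (ℕ.*-monoʳ-≤ m N≤M))
    d≡ : + d ≡ + n + + M - + 1
    d≡ = sym (trans (cong (_- + 1) (cong +_ n+M≡)) refl)

theorem3p9 : ∀ (n d m : ℕ) (Q : Quiver n d) → Q ∈ 𝒬 n d m →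
    ∀ (δ : Multidegree d) → δ ∈ Ω₂ Q →
    + ∣ δ ∣ ≤ + m * (+ d - + n - + 1) + + 2 * + n
theorem3p9 n d m Q Q∈𝒬 δ δ∈Ω₂ = to-integers ∣ δ ∣ n d m (Ω₂-bound Q Q∈𝒬 δ∈Ω₂)
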